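{- $\mathrm{Ratio}_{z,c}(n) \in \Theta(\log n)$ as $n\to\infty$; that is, the worst-case ratio of the number of Lempel--Ziv phrases to the minimum collage system size over strings of length $n$ is $\Theta(\log n)$.
   Context: $\mathrm{Ratio}_{z,c}(n)=\max_{S\in\Sigma^n} z(S)/c(S)$, where $S$ ranges over all strings of length $n$ over an alphabet $\Sigma$ of unrestricted size (i.e. arbitrary alphabets; the number of distinct characters may grow with $n$). Strings are indexed from $0$: a string $S$ of length $n=|S|$ is $S[0]\cdots S[n-1]$, and $S[i..j]$ is the substring from position $i$ to position $j$. A factorization of $S$ is a sequence of nonempty strings (phrases) $F_1,\dots,F_m$ with $S=F_1\cdots F_m$; the starting position of $F_i$ is $b_i=\sum_{k=1}^{i-1}|F_k|$. The Lempel--Ziv (LZ) factorization of $S$ is built from left to right: if the character $S[b_i]$ has no occurrence in $S$ starting before $b_i$, then $F_i=S[b_i]$; otherwise $F_i$ is the longest prefix of $S[b_i..n-1]$ that has an occurrence in $S$ starting before $b_i$ (this earlier occurrence may overlap $F_i$). The number of phrases is denoted $z(S)$. A collage system is a sequence of nonterminals $X_1,\dots,X_m$ with exactly one production rule for each nonterminal; the rule for $X_i$ has one of the following forms and recursively defines a string $\exp(X_i)$: (1) $X_i\to a$ for a character $a$, with $\exp(X_i)=a$; (2) $X_i\to X_jX_k$ with $j,k<i$, with $\exp(X_i)=\exp(X_j)\exp(X_k)$; (3) $X_i\to (X_j)^r$ with $j<i$ and an integer $r\ge 2$, with $\exp(X_i)=\exp(X_j)^r$; (4) $X_i\to X_j[b..e]$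 with $j<i$ and integers $0\le b\le e<|\exp(X_j)|$, with $\exp(X_i)=\exp(X_j)[b..e]$. The system derives $S$ if $\exp(X_m)=S$; its size is $m$. $c(S)$ is the minimum size of a collage system deriving $S$. -}

module Defs where

open import Data.Empty using (⊥)
open import Data.Fin.Base using (Fin)
open import Data.Integer.Base using (+_)
open import Data.List.Base using (List; []; _∷_; [_]; _++_; length; take; drop; replicate; concat)
open import Data.List.Relation.Binary.Prefix.Heterogeneous using (Prefix)
open import Data.Nat.Base using (ℕ; suc; _+_; _∸_; _≤_; _<_)
open import Data.Nat.Logarithm using (⌊log₂_⌋)
open import Data.Product.Base using (Σ-syntax; ∃-syntax; _×_)
open import Data.Rational.Base as ℚ using (ℚ; 0ℚ; _/_)
open import Data.Vec.Base as Vec using (Vec; []; _∷_; lookup; toList)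
open import Level using (Level)
open import Relation.Binary.Definitions using (DecidableEquality)
open import Relation.Binary.PropositionalEquality.Core using (_≡_)
open import Relation.Nullary.Negation.Core using (¬_)

private
  variable
    ℓ : Level
    A : Set
    a : A
    F S T : List A
    Fs : List (List A)
    b k m n : ℕ

Minimum : (ℕ → Set ℓ) → ℕ → Set ℓ
Minimum P m = P m × (∀ k → P k → m ≤ k)

Maximum : (ℚ → Set ℓ) → ℚ → Set ℓ
Maximum P q = P q × (∀ r → P r → r ℚ.≤ q)

-- F has an occurrence in S starting before position b; the occurrence
-- itself may extend past b.
OccursBefore : List A → ℕ → List A → Set
OccursBefore S b F = ∃[ pre ] ∃[ post ] (length pre < b × S ≡ pre ++ F ++ post)

LongestPrefix : (List A → Set) → List A → List A → Set
LongestPrefix P T F =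
  Prefix _≡_ F T × P F × (∀ G → Prefix _≡_ G T → P G → length G ≤ length F)

-- LZPhrase S b T F: F is the LZ phrase starting at position b of S, where
-- T is the suffix of S from position b on.
data LZPhrase {A : Set} (S : List A) (b : ℕ) : List A → List A → Set where
  fresh : ¬ OccursBefore S b [ a ] → LZPhrase S b (a ∷ T) [ a ]
  copy  : OccursBefore S b [ a ] →
          LongestPrefix (OccursBefore S b) (a ∷ T) F →
          LZPhrase S b (a ∷ T) F

-- LZFrom S b T Fs: Fs are the LZ phrases of S from position b on, which
-- together spell the suffix T of S.
data LZFrom {A : Set} (S : List A) : ℕ → List A → List (List A) → Set where
  []  : LZFrom S b [] []
  _∷_ : LZPhrase S b (F ++ T) F → LZFrom S (b + length F) T Fs →
        LZFrom S b (F ++ T) (F ∷ Fs)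

IsLZ : List A → List (List A) → Set
IsLZ S Fs = LZFrom S 0 S Fs

z[_]≡_ : List A → ℕ → Set
z[ S ]≡ k = ∃[ Fs ] (IsLZ S Fs × length Fs ≡ k)

_^_ : List A → ℕ → List A
u ^ r = concat (replicate r u)

_[_‥_] : List A → ℕ → ℕ → List A
u [ b ‥ e ] = take (suc e ∸ b) (drop b u)

-- The right-hand side of a production whose admissible nonterminals are
-- indexed by Fin m and have the expansions E.
data Rule (A : Set) {m : ℕ} (E : Vec (List A) m) : Set where
  char   : A → Rule A E
  pair   : (j k : Fin m) → Rule A E
  power  : (j : Fin m) (r : ℕ) → 2 ≤ r → Rule A E
  substr : (j : Fin m) (b e : ℕ) → b ≤ e → e < length (lookup E j) → Rule A E

⟦_⟧ : {E : Vec (List A) m} → Rule A E → List A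
⟦_⟧         (char a)             = [ a ]
⟦_⟧ {E = E} (pair j k)           = lookup E j ++ lookup E k
⟦_⟧ {E = E} (power j r _)        = lookup E j ^ r
⟦_⟧ {E = E} (substr j b e _ _)   = lookup E j [ b ‥ e ]

-- Collage systems with m nonterminals. Each new rule can refer only to the
-- nonterminals before it, so the condition j , k < i is built in.
-- References count backwards: Fin.zero is the most recent nonterminal.
data Collage (A : Set) : ℕ → Set
expansions : Collage A m → Vec (List A) m

data Collage A where
  []  : Collage A 0
  _▷_ : (G : Collage A m) → Rule A (expansions G) → Collage A (suc m)

expansions []      = []
expansions (G ▷ ρ) = ⟦ ρ ⟧ ∷ expansions G

_Derives_ : Collage A m → List A → Set
[]      Derives S = ⊥
(G ▷ ρ) Derives S = ⟦ ρ ⟧ ≡ S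

c[_]≡_ : List A → ℕ → Set
c[_]≡_ {A} S = Minimum (λ m → Σ[ G ∈ Collage A m ] G Derives S)

-- The values z(S)/c(S) over all strings S of length n over all alphabets.
-- c(S) is never 0, since the empty system derives nothing.
data Quotient (n : ℕ) : ℚ → Set₁ where
  quotient : {A : Set} → DecidableEquality A → (S : Vec A n) →
             z[ toList S ]≡ k → c[ toList S ]≡ suc m →
             Quotient n (+ k / suc m)

Ratio[z,c] : ℕ → ℚ → Set₁
Ratio[z,c] n = Maximum (Quotient n)

-- Rounding the logarithm down changes it by a factor of at most 2 for
-- n ≥ 2, which is immaterial inside Θ.
log : ℕ → ℚ
log n = + ⌊log₂ n ⌋ / 1

-- f ∈Θ g for a quantity f given by its graph: for all large n, f has a value
-- at n, and every such value lies between c₁ g(n) and c₂ g(n). Existence of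
-- the value is asserted classically (¬ ¬), since minima and maxima over
-- infinite families need not be computable; the bounds are constructive.
_∈Θ_ : (ℕ → ℚ → Set ℓ) → (ℕ → ℚ) → Set ℓ
f ∈Θ g =
  ∃[ c₁ ] ∃[ c₂ ] ∃[ N ]
    (0ℚ ℚ.< c₁ × 0ℚ ℚ.< c₂ ×
     (∀ n → N ≤ n →
        ¬ ¬ (∃[ q ] f n q) ×
        (∀ q → f n q → c₁ ℚ.* g n ℚ.≤ q × q ℚ.≤ c₂ ℚ.* g n)))

module Submission where

-- Upper bound: a collage system with m nonterminals produces at most mℓ distinct
-- substrings of length ℓ, since a pair or power rule adds only those straddling the
-- boundary of its first factor. A phrase of length between w and 2w makes the w substrings
-- of length 3w starting just before it occur there for the first time, so there are O(m)
-- such phrases for each of the O(log n) powers of two w.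
--
-- Lower bound: start from K = 2^M unmarked columns and mark them one at a time in
-- bit-reversed order; this gives K + 1 rows, each obtained from the previous one by
-- changing a letter, so a collage system of size O(K) produces them all. Concatenate the
-- intermediate rows in the order of a binary search: at the middle of a time interval of
-- length 2^j, the columns marked in its first and second half alternate, and no earlier row
-- contains a marked column of the first half together with an unmarked one of the second.
-- This forces 2^(j-1) phrase boundaries, and summing over all intervals gives M K / 2.

open import Defs
open import Data.Bool.Base using (Bool; true; false)
import Data.Bool.Properties as Bool
open import Data.Empty using (⊥)
open import Data.Fin.Base using (zero; suc)
open import Data.Integer.Base as ℤ using () renaming (+_ to pos)
import Data.Integer.Properties as ℤ
open import Data.List.Base
  using (List; []; _∷_; [_]; _++_; length; take; drop; map; replicate; concat; filter;
         applyUpTo; upTo; cartesianProductWith)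
open import Data.List.Membership.Propositional using (_∈_)
open import Data.List.Membership.Propositional.Properties
  using (∈-++⁺ˡ; ∈-++⁺ʳ; ∈-applyUpTo⁺; ∈-upTo⁺; ∈-cartesianProductWith⁺)
open import Data.List.Properties
import Data.List.Relation.Binary.Pointwise as Pointwise
open import Data.List.Relation.Binary.Prefix.Heterogeneous using (Prefix; []; _∷_; _++ᵖ_)
open import Data.List.Relation.Binary.Prefix.Heterogeneous.Properties using (fromPointwise; length-mono)
open import Data.List.Relation.Unary.All as All using (All; []; _∷_)
import Data.List.Relation.Unary.All.Properties as All
open import Data.List.Relation.Unary.AllPairs as AllPairs using (AllPairs; []; _∷_)
import Data.List.Relation.Unary.AllPairs.Properties as AllPairs
open import Data.List.Relation.Unary.Any as Any using (Any; here; there)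
import Data.List.Relation.Unary.Any.Properties as Any
open import Data.Maybe.Base using (Maybe; just; nothing)
open import Data.Maybe.Properties using (just-injective)
open import Data.Nat.Base as ℕ
  using (ℕ; zero; suc; _+_; _*_; _∸_; _⊓_; _≤_; _<_; _>_; z≤n; s≤s; ⌊_/2⌋; ⌈_/2⌉)
open import Data.Nat.ListAction using (sum)
open import Data.Nat.Logarithm
  using (⌊log₂_⌋; ⌊log₂⌋-mono-≤; ⌊log₂⌊n/2⌋⌋≡⌊log₂n⌋∸1; ⌊log₂[2^n]⌋≡n)
open import Data.Nat.Properties
open import Data.Nat.Tactic.RingSolver using (solve-∀)
open import Data.Product.Base using (Σ-syntax; ∃-syntax; _×_; _,_; proj₁; proj₂)
open import Data.Product.Properties using () renaming (≡-dec to ×-≡-dec)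
open import Data.Rational.Base as ℚ using (_/_; toℚᵘ)
import Data.Rational.Properties as ℚ
open import Data.Rational.Unnormalised.Base as ℚᵘ using (mkℚᵘ; *≡*; *≤*)
import Data.Rational.Unnormalised.Properties as ℚᵘ
open import Data.Sum.Base as Sum using (_⊎_; inj₁; inj₂)
open import Data.Vec.Base using (Vec; lookup; toList; fromList)
open import Data.Vec.Properties using (toList∘fromList; length-toList)
open import Function.Base using (_∘_; id; const; flip)
open import Level using (Level)
open import Relation.Binary.Definitions using (DecidableEquality; Transitive)
open import Relation.Binary.PropositionalEquality
  using (_≡_; _≢_; refl; sym; trans; cong; cong₂; subst; subst₂; module ≡-Reasoning)
open import Relation.Nullary using (¬_; Dec; yes; no; contradiction)
open import Relation.Nullary.Decidable using (_×-dec_; decidable-stable)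
open import Relation.Unary using (Decidable)

private
  variable
    ℓ₁ ℓ₂ ℓ₃ : Level
    A : Set
    m n : ℕ

-- Distinct substrings and the upper bound

∈-removeAt : ∀ {x y : A} {ys} (x∈ : x ∈ ys) → y ∈ ys → y ≢ x → y ∈ (ys Any.─ x∈)
∈-removeAt (here refl) (here refl) y≢x = contradiction refl y≢x
∈-removeAt (here refl) (there y∈)  _   = y∈
∈-removeAt (there x∈)  (here refl) _   = here refl
∈-removeAt (there x∈)  (there y∈)  y≢x = there (∈-removeAt x∈ y∈ y≢x)

length-─-suc : ∀ {x : A} {ys} (x∈ : x ∈ ys) → length ys ≡ suc (length (ys Any.─ x∈))
length-─-suc (here _)             = refl
length-─-suc {ys = _ ∷ _} (there x∈) = cong suc (length-─-suc x∈)

unique⊆⇒length≤ : ∀ {xs ys : List A} → AllPairs _≢_ xs → All (_∈ ys) xs → length xs ≤ length ys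
unique⊆⇒length≤ []           []         = z≤n
unique⊆⇒length≤ {ys = ys} (x≢xs ∷ xs!) (x∈ ∷ xs∈) rewrite length-─-suc x∈ =
  s≤s (unique⊆⇒length≤ xs! (All.zipWith (λ (y∈ , x≢y) → ∈-removeAt x∈ y∈ (x≢y ∘ sym)) (xs∈ , x≢xs)))

-- A window that overruns the end of `X` is cut short, so the last windows of a string are its short
-- suffixes.
window : ℕ → ℕ → List A → List A
window ℓ s X = take ℓ (drop s X)

take-++ˡ : ∀ k (X : List A) {Y} → k ≤ length X → take k (X ++ Y) ≡ take k X
take-++ˡ zero    X       _       = refl
take-++ˡ (suc k) (x ∷ X) (s≤s h) = cong (x ∷_) (take-++ˡ k X h)

drop-++ʳ : ∀ s (X : List A) {Y} → length X ≤ s → drop s (X ++ Y) ≡ drop (s ∸ length X) Y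
drop-++ʳ s       []      _       = refl
drop-++ʳ (suc s) (x ∷ X) (s≤s h) = drop-++ʳ s X h

window-++ˡ : ∀ ℓ s (X : List A) {Y} → s + ℓ ≤ length X → window ℓ s (X ++ Y) ≡ window ℓ s X
window-++ˡ ℓ zero    X       h       = take-++ˡ ℓ X h
window-++ˡ ℓ (suc s) (x ∷ X) (s≤s h) = window-++ˡ ℓ s X h

window-++ʳ : ∀ ℓ s (X : List A) {Y} → length X ≤ s →
             window ℓ s (X ++ Y) ≡ window ℓ (s ∸ length X) Y
window-++ʳ ℓ s X h = cong (take ℓ) (drop-++ʳ s X h)

^-+ : ∀ (X : List A) a b → X ^ (a + b) ≡ X ^ a ++ X ^ b
^-+ X zero    b = refl
^-+ X (suc a) b = trans (cong (X ++_) (^-+ X a b)) (sym (++-assoc X (X ^ a) (X ^ b)))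

-- By periodicity a window of a power of X can be moved back until it starts inside the
-- first X, so these windows suffice for powers as well as for pairs.
straddling : ℕ → List A → List A → List (List A)
straddling ℓ X W = applyUpTo (λ i → window ℓ (length X ∸ i) W) ℓ

newWindows : ℕ → {E : Vec (List A) m} → Rule A E → List (List A)
newWindows ℓ         (char a)         = [ [ a ] ]
newWindows ℓ {E = E} (pair j k)       = straddling ℓ (lookup E j) (lookup E j ++ lookup E k)
newWindows ℓ {E = E} (power j r _)    = straddling ℓ (lookup E j) (lookup E j ^ r)
newWindows ℓ         (substr _ _ _ _ _) = []

windows : ℕ → Collage A m → List (List A)
windows ℓ []      = []
windows ℓ (G ▷ ρ) = newWindows ℓ ρ ++ windows ℓ G

length-windows : ∀ ℓ → 1 ≤ ℓ → (G : Collage A m) → length (windows ℓ G) ≤ m * ℓ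
length-windows ℓ 1≤ℓ []      = z≤n
length-windows ℓ 1≤ℓ (G ▷ ρ) =
  ≤-trans (≤-reflexive (length-++ (newWindows ℓ ρ))) (+-mono-≤ (new ρ) (length-windows ℓ 1≤ℓ G))
  where
  new : ∀ ρ → length (newWindows ℓ {E = expansions G} ρ) ≤ ℓ
  new (char a)            = 1≤ℓ
  new (pair j k)          = ≤-reflexive (length-applyUpTo _ ℓ)
  new (power j r _)       = ≤-reflexive (length-applyUpTo _ ℓ)
  new (substr _ _ _ _ _)  = z≤n

Covers : ℕ → List (List A) → List A → Set
Covers ℓ 𝓦 X = ∀ s → s + ℓ ≤ length X → window ℓ s X ∈ 𝓦

module _ {ℓ : ℕ} {𝓦 : List (List A)} (X : List A) (cX : Covers ℓ 𝓦 X) where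

  private
    straddle : ∀ s W → s < length X → length X < s + ℓ → window ℓ s W ∈ straddling ℓ X W
    straddle s W s<X X<s+ℓ =
      subst (λ t → window ℓ t W ∈ straddling ℓ X W) (m∸[m∸n]≡n (<⇒≤ s<X))
        (∈-applyUpTo⁺ (λ i → window ℓ (length X ∸ i) W)
          (m<n+o⇒m∸n<o (length X) s {{ℕ.>-nonZero 0<ℓ}} X<s+ℓ))
      where
      0<ℓ : 0 < ℓ
      0<ℓ = +-cancelˡ-< s 0 ℓ (subst (_< s + ℓ) (sym (+-identityʳ s)) (<-trans s<X X<s+ℓ))

  covers-pair : ∀ {Y} → Covers ℓ 𝓦 Y → Covers ℓ (straddling ℓ X (X ++ Y) ++ 𝓦) (X ++ Y)
  covers-pair {Y} cY s s+ℓ≤ with s + ℓ ≤? length X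
  ... | yes h = ∈-++⁺ʳ _ (subst (_∈ 𝓦) (sym (window-++ˡ ℓ s X h)) (cX s h))
  ... | no ¬h with s <? length X
  ...   | yes s<X = ∈-++⁺ˡ (straddle s (X ++ Y) s<X (≰⇒> ¬h))
  ...   | no  s≮X = ∈-++⁺ʳ _ (subst (_∈ 𝓦) (sym (window-++ʳ ℓ s X X≤s)) (cY _ fits))
    where
    X≤s = ≮⇒≥ s≮X
    fits : s ∸ length X + ℓ ≤ length Y
    fits = +-cancelˡ-≤ (length X) _ _ (begin
      length X + (s ∸ length X + ℓ) ≡⟨ +-assoc (length X) _ ℓ ⟨
      length X + (s ∸ length X) + ℓ ≡⟨ cong (_+ ℓ) (m+[n∸m]≡n X≤s) ⟩
      s + ℓ                         ≤⟨ s+ℓ≤ ⟩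
      length (X ++ Y)               ≡⟨ length-++ X ⟩
      length X + length Y           ∎)
      where open ≤-Reasoning

  -- Induction on the number `r′` of copies still ahead: a window that starts after the first copy
  -- moves back by `length X`. The straddling windows keep referring to all of `X ^ r`, which begins
  -- with `X ^ r′`.
  covers-power : ∀ r → Covers ℓ (straddling ℓ X (X ^ r) ++ 𝓦) (X ^ r)
  covers-power r = go r 0 (+-identityʳ r)
    where
    go : ∀ r′ d → r′ + d ≡ r → Covers ℓ (straddling ℓ X (X ^ r) ++ 𝓦) (X ^ r′)
    -- Here `s` and `ℓ` are 0, so the window is empty and equals the empty window of `X`.
    go zero     d eq s s+ℓ≤ with refl ← m+n≡0⇒m≡0 s (n≤0⇒n≡0 s+ℓ≤) | refl ← m+n≡0⇒n≡0 s (n≤0⇒n≡0 s+ℓ≤) =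
      ∈-++⁺ʳ _ (cX 0 z≤n)
    go (suc r′) d eq s s+ℓ≤ with s + ℓ ≤? length X
    ... | yes h = ∈-++⁺ʳ _ (subst (_∈ 𝓦) (sym (window-++ˡ ℓ s X h)) (cX s h))
    ... | no ¬h with s <? length X
    ...   | yes s<X = ∈-++⁺ˡ (subst (_∈ straddling ℓ X (X ^ r)) extend (straddle s (X ^ r) s<X (≰⇒> ¬h)))
      where
      extend : window ℓ s (X ^ r) ≡ window ℓ s (X ^ suc r′)
      extend = trans (cong (window ℓ s) (trans (cong (X ^_) (sym eq)) (^-+ X (suc r′) d)))
                     (window-++ˡ ℓ s (X ^ suc r′) s+ℓ≤)
    ...   | no  s≮X = subst (_∈ _) (sym (window-++ʳ ℓ s X X≤s))
                        (go r′ (suc d) (trans (+-suc r′ d) eq) _ fits)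
      where
      X≤s = ≮⇒≥ s≮X
      fits : s ∸ length X + ℓ ≤ length (X ^ r′)
      fits = +-cancelˡ-≤ (length X) _ _ (begin
        length X + (s ∸ length X + ℓ) ≡⟨ +-assoc (length X) _ ℓ ⟨
        length X + (s ∸ length X) + ℓ ≡⟨ cong (_+ ℓ) (m+[n∸m]≡n X≤s) ⟩
        s + ℓ                         ≤⟨ s+ℓ≤ ⟩
        length (X ++ X ^ r′)          ≡⟨ length-++ X ⟩
        length X + length (X ^ r′)    ∎)
        where open ≤-Reasoning

  covers-substr : ∀ b e → b ≤ length X → Covers ℓ 𝓦 (X [ b ‥ e ])
  covers-substr b e b≤ s s+ℓ≤ = subst (_∈ 𝓦) same (cX (b + s) inX)
    where
    inX : b + s + ℓ ≤ length X
    inX = begin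
      b + s + ℓ              ≡⟨ +-assoc b s ℓ ⟩
      b + (s + ℓ)            ≤⟨ +-monoʳ-≤ b s+ℓ≤ ⟩
      b + length (X [ b ‥ e ]) ≡⟨ cong (b +_) (length-take (suc e ∸ b) (drop b X)) ⟩
      b + ((suc e ∸ b) ⊓ length (drop b X)) ≤⟨ +-monoʳ-≤ b (m⊓n≤n _ _) ⟩
      b + length (drop b X)  ≡⟨ cong (b +_) (length-drop b X) ⟩
      b + (length X ∸ b)     ≡⟨ m+[n∸m]≡n b≤ ⟩
      length X               ∎
      where open ≤-Reasoning
    same : window ℓ (b + s) X ≡ window ℓ s (X [ b ‥ e ])
    same = begin
      window ℓ (b + s) X                  ≡⟨ cong (take ℓ) (drop-drop b s X) ⟨
      window ℓ s (drop b X)               ≡⟨ cong (window ℓ s) (take++drop≡id (suc e ∸ b) (drop b X)) ⟨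
      window ℓ s (X [ b ‥ e ] ++ _)       ≡⟨ window-++ˡ ℓ s (X [ b ‥ e ]) s+ℓ≤ ⟩
      window ℓ s (X [ b ‥ e ])            ∎
      where open ≡-Reasoning

covers-rule : ∀ {ℓ} → 1 ≤ ℓ → (G : Collage A m) →
              (∀ j → Covers ℓ (windows ℓ G) (lookup (expansions G) j)) →
              (ρ : Rule A (expansions G)) → Covers ℓ (newWindows ℓ ρ ++ windows ℓ G) ⟦ ρ ⟧
covers-rule {ℓ = suc zero} _ G cG (char a) zero    _ = here refl
covers-rule {ℓ = suc (suc _)} _ G cG (char a) zero (s≤s ())
covers-rule {ℓ = suc _}    _ G cG (char a) (suc s) (s≤s h) =
  contradiction (≤-trans (≤-reflexive (sym (+-suc s _))) h) λ ()
covers-rule 1≤ℓ G cG (pair j k)         = covers-pair _ (cG j) (cG k)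
covers-rule 1≤ℓ G cG (power j r _)      = covers-power _ (cG j) r
covers-rule 1≤ℓ G cG (substr j b e b≤e e<) =
  covers-substr _ (cG j) b e (≤-trans b≤e (<⇒≤ e<))

covers-windows : ∀ {ℓ} → 1 ≤ ℓ → (G : Collage A m) → ∀ j → Covers ℓ (windows ℓ G) (lookup (expansions G) j)
covers-windows 1≤ℓ (G ▷ ρ) zero    = covers-rule 1≤ℓ G (covers-windows 1≤ℓ G) ρ
covers-windows 1≤ℓ (G ▷ ρ) (suc j) s h = ∈-++⁺ʳ (newWindows _ ρ) (covers-windows 1≤ℓ G j s h)

covers-derived : ∀ {ℓ S} → 1 ≤ ℓ → (G : Collage A m) → G Derives S → Covers ℓ (windows ℓ G) S
covers-derived 1≤ℓ (G ▷ ρ) refl = covers-windows 1≤ℓ (G ▷ ρ) zero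

-- Positions where a window occurs for the first time

Novel : ℕ → List A → ℕ → Set
Novel ℓ S s = ∀ s₀ → s₀ < s → window ℓ s₀ S ≢ window ℓ s S

-- Windows at novel positions are pairwise distinct. Those that fit into `S` are among the at most
-- `m * ℓ` windows of the system, and those cut short are among `ℓ` suffixes.
novels-bound : ∀ {ℓ} {S : List A} {ms} → 1 ≤ ℓ → (G : Collage A m) → G Derives S →
               AllPairs _<_ ms → All (λ s → s ≤ length S × Novel ℓ S s) ms →
               length ms ≤ m * ℓ + ℓ
novels-bound {m = m} {ℓ} {S} {ms} 1≤ℓ G der ms< good = begin
  length ms                                ≡⟨ length-map word ms ⟨
  length (map word ms)                     ≤⟨ unique⊆⇒length≤ distinct (All.map⁺ (All.map listed good)) ⟩
  length (windows ℓ G ++ suffixes)         ≡⟨ length-++ (windows ℓ G) ⟩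
  length (windows ℓ G) + length suffixes   ≤⟨ +-mono-≤ (length-windows ℓ 1≤ℓ G) (≤-reflexive (length-applyUpTo _ ℓ)) ⟩
  m * ℓ + ℓ                                ∎
  where
  open ≤-Reasoning
  word = λ s → window ℓ s S
  suffixes = applyUpTo (λ i → drop (length S ∸ i) S) ℓ
  distinct : AllPairs _≢_ (map word ms)
  distinct = AllPairs.map⁺ (go ms< good)
    where
    go : ∀ {ms} → AllPairs _<_ ms → All (λ s → s ≤ length S × Novel ℓ S s) ms →
         AllPairs (λ s s′ → word s ≢ word s′) ms
    go []           []       = []
    go (s< ∷ ms<) (_ ∷ good) =
      All.zipWith (λ (s<s′ , _ , nov) → nov _ s<s′) (s< , good) ∷ go ms< good
  listed : ∀ {s} → s ≤ length S × Novel ℓ S s → word s ∈ windows ℓ G ++ suffixes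
  listed {s} (s≤ , _) with s + ℓ ≤? length S
  ... | yes h = ∈-++⁺ˡ (covers-derived 1≤ℓ G der s h)
  ... | no ¬h = ∈-++⁺ʳ (windows ℓ G) (subst (_∈ suffixes) eq (∈-applyUpTo⁺ _ i<ℓ))
    where
    i<ℓ : length S ∸ s < ℓ
    i<ℓ = m<n+o⇒m∸n<o (length S) s {{ℕ.>-nonZero 1≤ℓ}} (≰⇒> ¬h)
    eq : drop (length S ∸ (length S ∸ s)) S ≡ word s
    eq = trans (cong (λ t → drop t S) (m∸[m∸n]≡n s≤))
               (sym (take-all ℓ (drop s S) (≤-trans (≤-reflexive (length-drop s S)) (<⇒≤ i<ℓ))))

-- A fresh letter has no earlier occurrence, so no extension of it has one; for a copied phrase this
-- is maximality. The text `U` is tied to `F` by an equation because a concatenation in the index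
-- would block matching on the phrase.
¬occursLonger : ∀ {S : List A} {b F x T U} → LZPhrase S b U F → U ≡ F ++ x ∷ T →
                ¬ OccursBefore S b (F ++ [ x ])
¬occursLonger (fresh ¬occ) _ (pre , post , pre< , eq) = ¬occ (pre , _ , pre< , eq)
¬occursLonger {F = F} {x} {T} (copy _ (_ , _ , longest)) eq occ =
  <⇒≱ (≤-reflexive (trans (+-comm 1 (length F)) (sym (length-++ F))))
      (longest _ (subst (Prefix _≡_ (F ++ [ x ])) (sym eq) prefix) occ)
  where
  prefix : Prefix _≡_ (F ++ [ x ]) (F ++ x ∷ T)
  prefix = subst (Prefix _≡_ (F ++ [ x ])) (++-assoc F [ x ] T) (fromPointwise (Pointwise.refl refl) ++ᵖ T)

-- The window from `s` contains the phrase and the letter after it. An earlier copy of the window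
-- would give, `b ∸ s` letters further on, an earlier occurrence of the phrase extended by that
-- letter.
phrase-novel : ∀ {S : List A} {b F T s ℓ} → LZPhrase S b (F ++ T) F → drop b S ≡ F ++ T → b ≤ length S →
               s ≤ b → b + length F < s + ℓ → Novel ℓ S s
phrase-novel {S = S} {b} {F} {T} {s} {ℓ} ph dropS b≤ s≤b fits s₀ s₀<s eq = shorter T ph dropS agree
  where
  δ = b ∸ s
  p = s₀ + δ
  p<b : p < b
  p<b = subst (p <_) (m+[n∸m]≡n s≤b) (+-monoˡ-< δ s₀<s)
  δ+f<ℓ : δ + length F < ℓ
  δ+f<ℓ = +-cancelˡ-< s _ _ (subst (_< s + ℓ)
    (trans (cong (_+ length F) (sym (m+[n∸m]≡n s≤b))) (+-assoc s δ _)) fits)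
  k = ℓ ∸ δ
  δ+k : δ + k ≡ ℓ
  δ+k = m+[n∸m]≡n (≤-trans (m≤m+n δ _) (<⇒≤ δ+f<ℓ))
  f<k : length F < k
  f<k = +-cancelˡ-< δ _ _ (subst (δ + length F <_) (sym δ+k) δ+f<ℓ)
  shift : ∀ t → drop δ (window ℓ t S) ≡ window k (t + δ) S
  shift t = begin
    drop δ (take ℓ (drop t S))        ≡⟨ cong (λ z → drop δ (take z (drop t S))) δ+k ⟨
    drop δ (take (δ + k) (drop t S))  ≡⟨ take-drop k δ (drop t S) ⟨
    take k (drop δ (drop t S))        ≡⟨ cong (take k) (drop-drop t δ S) ⟩
    window k (t + δ) S                ∎
    where open ≡-Reasoning
  agree : window k p S ≡ take k (drop b S)
  agree = begin
    window k p S            ≡⟨ shift s₀ ⟨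
    drop δ (window ℓ s₀ S)  ≡⟨ cong (drop δ) eq ⟩
    drop δ (window ℓ s S)   ≡⟨ shift s ⟩
    window k (s + δ) S      ≡⟨ cong (λ z → window k z S) (m+[n∸m]≡n s≤b) ⟩
    window k b S            ∎
    where open ≡-Reasoning
  shorter : ∀ T → LZPhrase S b (F ++ T) F → drop b S ≡ F ++ T → ¬ (window k p S ≡ take k (drop b S))
  -- If the phrase ends the string, there is no next letter. The lengths then differ: the window
  -- from `b` is cut short, and the one from `p < b` has more letters.
  shorter [] _ dropS agree = <⇒≢ (⊓-glb |F|<k (∸-monoʳ-< p<b b≤)) (sym lengths)
    where
    |dropS| : length S ∸ b ≡ length F
    |dropS| = trans (sym (length-drop b S)) (trans (cong length dropS) (cong length (++-identityʳ F)))
    |F|<k : length S ∸ b < k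
    |F|<k = subst (_< k) (sym |dropS|) f<k
    lengths : k ⊓ (length S ∸ p) ≡ length S ∸ b
    lengths = begin
      k ⊓ (length S ∸ p)          ≡⟨ cong (k ⊓_) (length-drop p S) ⟨
      k ⊓ length (drop p S)       ≡⟨ length-take k (drop p S) ⟨
      length (window k p S)       ≡⟨ cong length agree ⟩
      length (take k (drop b S))  ≡⟨ length-take k (drop b S) ⟩
      k ⊓ length (drop b S)       ≡⟨ cong (k ⊓_) (length-drop b S) ⟩
      k ⊓ (length S ∸ b)          ≡⟨ m≥n⇒m⊓n≡n (<⇒≤ |F|<k) ⟩
      length S ∸ b                ∎
      where open ≡-Reasoning
  shorter (x ∷ T) ph dropS agree = ¬occursLonger ph refl (take p S , drop (suc f) (drop p S) , pre< , spelled)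
    where
    f = length F
    pre< : length (take p S) < b
    pre< = ≤-<-trans (≤-trans (≤-reflexive (length-take p S)) (m⊓n≤m p _)) p<b
    front : take (suc f) (drop p S) ≡ F ++ [ x ]
    front = begin
      take (suc f) (drop p S)              ≡⟨ cong (λ z → take z (drop p S)) (m≤n⇒m⊓n≡m f<k) ⟨
      take (suc f ⊓ k) (drop p S)          ≡⟨ take-take (suc f) k (drop p S) ⟨
      take (suc f) (window k p S)          ≡⟨ cong (take (suc f)) agree ⟩
      take (suc f) (take k (drop b S))     ≡⟨ take-take (suc f) k (drop b S) ⟩
      take (suc f ⊓ k) (drop b S)          ≡⟨ cong₂ take (m≤n⇒m⊓n≡m f<k) dropS ⟩
      take (suc f) (F ++ x ∷ T)            ≡⟨ cong (take (suc f)) (++-assoc F [ x ] T) ⟨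
      take (suc f) ((F ++ [ x ]) ++ T)     ≡⟨ take-++ˡ (suc f) (F ++ [ x ]) (≤-reflexive (sym |Fx|)) ⟩
      take (suc f) (F ++ [ x ])            ≡⟨ take-all (suc f) (F ++ [ x ]) (≤-reflexive |Fx|) ⟩
      F ++ [ x ]                           ∎
      where
      open ≡-Reasoning
      |Fx| : length (F ++ [ x ]) ≡ suc f
      |Fx| = trans (length-++ F) (+-comm f 1)
    spelled : S ≡ take p S ++ (F ++ [ x ]) ++ drop (suc f) (drop p S)
    spelled = sym (begin
      take p S ++ (F ++ [ x ]) ++ drop (suc f) (drop p S)  ≡⟨ cong (λ z → take p S ++ z ++ _) front ⟨
      take p S ++ take (suc f) (drop p S) ++ drop (suc f) (drop p S)
        ≡⟨ cong (take p S ++_) (take++drop≡id (suc f) (drop p S)) ⟩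
      take p S ++ drop p S                                 ≡⟨ take++drop≡id p S ⟩
      S                                                    ∎)
      where open ≡-Reasoning

-- Phrases of one dyadic length

Scale : ℕ → List A → Set
Scale w F = w ≤ length F × length F < w + w

scale? : ∀ w → Decidable (Scale {A} w)
scale? w F = (w ≤? length F) ×-dec (length F <? w + w)

module _ {S : List A} where

  next-drop : ∀ {b F T} → drop b S ≡ F ++ T → drop (b + length F) S ≡ T
  next-drop {b} {F} {T} eq = begin
    drop (b + length F) S          ≡⟨ drop-drop b (length F) S ⟨
    drop (length F) (drop b S)     ≡⟨ cong (drop (length F)) eq ⟩
    drop (length F) (F ++ T)       ≡⟨ drop-++ʳ (length F) F ≤-refl ⟩
    drop (length F ∸ length F) T   ≡⟨ cong (λ z → drop z T) (n∸n≡0 (length F)) ⟩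
    T                              ∎
    where open ≡-Reasoning

  next-≤ : ∀ {b F T} → drop b S ≡ F ++ T → b ≤ length S → b + length F ≤ length S
  next-≤ {b} {F} {T} eq b≤ = begin
    b + length F           ≤⟨ +-monoʳ-≤ b (length-++-≤ˡ F) ⟩
    b + length (F ++ T)    ≡⟨ cong (λ z → b + length z) eq ⟨
    b + length (drop b S)  ≡⟨ cong (b +_) (length-drop b S) ⟩
    b + (length S ∸ b)     ≡⟨ m+[n∸m]≡n b≤ ⟩
    length S               ∎
    where open ≤-Reasoning

  module _ (w′ : ℕ) where
    private
      w = suc w′
      -- Room for a phrase shorter than `2w` together with the next letter, seen from each of the
      -- `w` start positions `b ∸ w′` to `b`.
      ℓ = w + (w + w)
      count : List (List A) → ℕ
      count Fs = length (filter (scale? w) Fs)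

    Mark : ℕ → ℕ → Set
    Mark lo s = lo ≤ s × s ≤ length S × Novel ℓ S s

    private
      swap : ∀ lo f w → lo + f + w ≡ lo + w + f
      swap = solve-∀

    -- A phrase of this scale starting at b marks the w positions b ∸ w′ , … , b.
    marks : ∀ {b T Fs} lo → lo + w′ ≡ b → LZFrom S b T Fs → drop b S ≡ T → b ≤ length S →
            ∃[ ms ] (AllPairs _<_ ms × All (Mark lo) ms × w * count Fs ≤ length ms)
    marks lo eq [] _ _ = [] , [] , [] , ≤-reflexive (*-zeroʳ w)
    marks {b} lo eq (_∷_ {F = F} {T = T} {Fs = Fs} ph lz) dropS b≤ with
      ms , ms< , good , len ← marks (lo + length F) (trans (swap lo (length F) w′) (cong (_+ length F) eq))
                                    lz (next-drop {b} {F} {T} dropS) (next-≤ {b} {F} {T} dropS b≤)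
      | scale? w F
    ... | no ¬sc = ms , ms< , All.map (λ (lo≤ , r) → m+n≤o⇒m≤o lo lo≤ , r) good ,
                   subst (λ z → w * length z ≤ length ms) (sym (filter-reject (scale? w) {F} {Fs} ¬sc)) len
    -- Since `F` has length at least `w`, all later marks lie at `lo + w` or beyond, after the new
    -- ones.
    ... | yes sc@(w≤ , <2w) = new ++ ms
      , AllPairs.++⁺ (AllPairs.applyUpTo⁺₁ (lo +_) w (λ i<j _ → +-monoʳ-< lo i<j)) ms<
          (All.applyUpTo⁺₁ (lo +_) w λ i<w →
            All.map (λ (lo≤ , _) → <-≤-trans (+-monoʳ-< lo (<-≤-trans i<w w≤)) lo≤) good)
      , All.++⁺ (All.applyUpTo⁺₁ (lo +_) w mark) (All.map (λ (lo≤ , r) → m+n≤o⇒m≤o lo lo≤ , r) good)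
      , (begin
          w * count (F ∷ Fs)        ≡⟨ cong (λ z → w * length z) (filter-accept (scale? w) {F} {Fs} sc) ⟩
          w * suc (count Fs)        ≡⟨ *-suc w (count Fs) ⟩
          w + w * count Fs          ≤⟨ +-mono-≤ (≤-reflexive (sym (length-applyUpTo (lo +_) w))) len ⟩
          length new + length ms    ≡⟨ length-++ new ⟨
          length (new ++ ms)        ∎)
      where
      open ≤-Reasoning
      new = applyUpTo (lo +_) w
      mark : ∀ {i} → i < w → Mark lo (lo + i)
      mark {i} (s≤s i≤) = m≤m+n lo i , ≤-trans i≤b b≤ , phrase-novel ph dropS b≤ i≤b (begin-strict
        b + length F          <⟨ +-monoʳ-< b <2w ⟩
        b + (w + w)           ≡⟨ cong (_+ (w + w)) eq ⟨
        lo + w′ + (w + w)     ≤⟨ +-monoˡ-≤ (w + w) (+-monoʳ-≤ lo (n≤1+n w′)) ⟩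
        lo + w + (w + w)      ≡⟨ +-assoc lo w (w + w) ⟩
        lo + ℓ                ≤⟨ +-monoˡ-≤ ℓ (m≤m+n lo i) ⟩
        lo + i + ℓ            ∎)
        where
        i≤b : lo + i ≤ b
        i≤b = subst (lo + i ≤_) eq (+-monoʳ-≤ lo i≤)

    -- Only the first phrase of this scale can lack the room for its marks.
    marks₀ : ∀ {b T Fs} → LZFrom S b T Fs → drop b S ≡ T → b ≤ length S →
             ∃[ ms ] (AllPairs _<_ ms × All (Mark 0) ms × w * count Fs ≤ w + length ms)
    marks₀ [] _ _ = [] , [] , [] , ≤-trans (≤-reflexive (*-zeroʳ w)) z≤n
    marks₀ {b} (_∷_ {F = F} {T = T} {Fs = Fs} ph lz) dropS b≤ with scale? w F
    ... | no ¬sc with ms , ms< , good , len ← marks₀ lz (next-drop {b} {F} {T} dropS) (next-≤ {b} {F} {T} dropS b≤) =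
      ms , ms< , good , subst (λ z → w * length z ≤ w + length ms) (sym (filter-reject (scale? w) {F} {Fs} ¬sc)) len
    ... | yes sc@(w≤ , _) with ms , ms< , good , len ←
            -- The phrase just passed has length at least `w`, so this subtraction is not truncated.
            marks (b + length F ∸ w′) (m∸n+n≡m (≤-trans (n≤1+n w′) (≤-trans w≤ (m≤n+m _ b))))
                  lz (next-drop {b} {F} {T} dropS) (next-≤ {b} {F} {T} dropS b≤) =
      ms , ms< , All.map (λ (_ , r) → z≤n , r) good , (begin
        w * count (F ∷ Fs)        ≡⟨ cong (λ z → w * length z) (filter-accept (scale? w) {F} {Fs} sc) ⟩
        w * suc (count Fs)        ≡⟨ *-suc w (count Fs) ⟩
        w + w * count Fs          ≤⟨ +-monoʳ-≤ w len ⟩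
        w + length ms             ∎)
      where open ≤-Reasoning

    -- Dividing by `w` leaves 1 for the first phrase of the scale and `3 * m + 3` for the windows of
    -- length `3w`; by `1 ≤ m` the sum is at most `7 * m`.
    scale-bound : ∀ {Fs} (G : Collage A m) → G Derives S → IsLZ S Fs → 1 ≤ m → count Fs ≤ 7 * m
    scale-bound {m = m} {Fs} G der lz 1≤m with ms , ms< , good , len ← marks₀ lz refl z≤n =
      *-cancelˡ-≤ w (begin
        w * count Fs               ≤⟨ len ⟩
        w + length ms              ≤⟨ +-monoʳ-≤ w (novels-bound (s≤s z≤n) G der ms< (All.map proj₂ good)) ⟩
        w + (m * ℓ + ℓ)            ≡⟨ cong₂ _+_ (sym (*-identityʳ w)) (rearrange w m) ⟩
        w * 1 + w * (3 * m + 3)    ≡⟨ *-distribˡ-+ w 1 (3 * m + 3) ⟨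
        w * (1 + (3 * m + 3))      ≡⟨ cong (w *_) (arith m) ⟩
        w * (3 * m + 4 * 1)        ≤⟨ *-monoʳ-≤ w (+-monoʳ-≤ (3 * m) (*-monoʳ-≤ 4 1≤m)) ⟩
        w * (3 * m + 4 * m)        ≡⟨ cong (w *_) (*-distribʳ-+ m 3 4) ⟨
        w * (7 * m)                ∎)
      where
      open ≤-Reasoning
      rearrange : ∀ w m → m * (w + (w + w)) + (w + (w + w)) ≡ w * (3 * m + 3)
      rearrange = solve-∀
      arith : ∀ m → 1 + (3 * m + 3) ≡ 3 * m + 4 * 1
      arith = solve-∀

-- Summation over the dyadic lengths

phrase-nonempty : ∀ {S : List A} {b T F} → LZPhrase S b T F → 1 ≤ length F
phrase-nonempty (fresh _) = s≤s z≤n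
phrase-nonempty (copy occ (_ , _ , longest)) = longest _ (refl ∷ []) occ

phrases-short : ∀ {S : List A} {b T Fs} → LZFrom S b T Fs → All (λ F → 1 ≤ length F × length F ≤ length T) Fs
phrases-short [] = []
phrases-short (_∷_ {F = F} {T = T} ph lz) =
  (phrase-nonempty ph , length-++-≤ˡ F) ∷
  All.map (λ (1≤ , ≤T) → 1≤ , ≤-trans ≤T (length-++-≤ʳ T {F})) (phrases-short lz)

short? : ∀ N → Decidable (λ (F : List A) → length F < N)
short? N F = length F <? N

doubling : ∀ w (Fs : List (List A)) →
           length (filter (short? (w + w)) Fs) ≤ length (filter (short? w) Fs) + length (filter (scale? w) Fs)
doubling w [] = z≤n
doubling w (F ∷ Fs) = split (length F <? w) (length F <? w + w)
  where
  ih = doubling w Fs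
  split : Dec (length F < w) → Dec (length F < w + w) →
          length (filter (short? (w + w)) (F ∷ Fs)) ≤
          length (filter (short? w) (F ∷ Fs)) + length (filter (scale? w) (F ∷ Fs))
  split (yes <w) _
    rewrite filter-accept (short? (w + w)) {F} {Fs} (<-≤-trans <w (m≤m+n w w))
          | filter-accept (short? w) {F} {Fs} <w
          | filter-reject (scale? w) {F} {Fs} (λ (w≤ , _) → <⇒≱ <w w≤) = s≤s ih
  split (no ≮w) (yes <2w)
    rewrite filter-reject (short? w) {F} {Fs} ≮w
          | filter-accept (scale? w) {F} {Fs} (≮⇒≥ ≮w , <2w)
          | filter-accept (short? (w + w)) {F} {Fs} <2w = ≤-trans (s≤s ih) (≤-reflexive (sym (+-suc _ _)))
  split (no ≮w) (no ≮2w)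
    rewrite filter-reject (short? w) {F} {Fs} ≮w
          | filter-reject (scale? w) {F} {Fs} (λ (_ , <2w) → ≮2w <2w)
          | filter-reject (short? (w + w)) {F} {Fs} ≮2w = ih

-- Each doubling of the length limit admits one further scale, hence at most `7 * m` phrases. Below
-- length 1 there are none because phrases are nonempty.
phrases-bound : ∀ {S : List A} {Fs} (G : Collage A m) → G Derives S → IsLZ S Fs → 1 ≤ m →
                ∀ i → length (filter (short? (2 ℕ.^ i)) Fs) ≤ i * (7 * m)
phrases-bound {Fs = Fs} G der lz 1≤m zero =
  ≤-reflexive (cong length (filter-none (short? 1) (All.map (λ (1≤ , _) → ≤⇒≯ 1≤) (phrases-short lz))))
phrases-bound {m = m} {Fs = Fs} G der lz 1≤m (suc i) = begin
  length (filter (short? (w + (w + 0))) Fs)  ≡⟨ cong (λ z → length (filter (short? (w + z)) Fs)) (+-identityʳ w) ⟩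
  length (filter (short? (w + w)) Fs)        ≤⟨ doubling w Fs ⟩
  _ + length (filter (scale? w) Fs)          ≤⟨ +-mono-≤ (phrases-bound G der lz 1≤m i) scales ⟩
  i * (7 * m) + 7 * m                        ≡⟨ +-comm (i * (7 * m)) (7 * m) ⟩
  suc i * (7 * m)                            ∎
  where
  open ≤-Reasoning
  w = 2 ℕ.^ i
  scales : length (filter (scale? w) Fs) ≤ 7 * m
  scales with w | m^n≢0 2 i
  ... | suc w′ | _ = scale-bound w′ G der lz 1≤m

n<2^[1+log₂n] : ∀ n → n < 2 ℕ.^ suc ⌊log₂ n ⌋
n<2^[1+log₂n] n with n <? 2 ℕ.^ suc ⌊log₂ n ⌋
... | yes h = h
... | no ¬h = contradiction
  (subst (_≤ ⌊log₂ n ⌋) (⌊log₂[2^n]⌋≡n (suc ⌊log₂ n ⌋)) (⌊log₂⌋-mono-≤ (≮⇒≥ ¬h))) (<⇒≱ (n<1+n _))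

z-bound : ∀ {S : List A} {Fs} (G : Collage A m) → G Derives S → IsLZ S Fs → 1 ≤ m →
          length Fs ≤ suc ⌊log₂ length S ⌋ * (7 * m)
z-bound {m = m} {S} {Fs} G der lz 1≤m =
  subst (_≤ suc ⌊log₂ length S ⌋ * (7 * m)) (cong length (filter-all (short? N) all))
    (phrases-bound G der lz 1≤m (suc ⌊log₂ length S ⌋))
  where
  N = 2 ℕ.^ suc ⌊log₂ length S ⌋
  all : All (λ F → length F < N) Fs
  all = All.map (λ (_ , ≤S) → ≤-<-trans ≤S (n<2^[1+log₂n] (length S))) (phrases-short lz)

-- Constructing collage systems

-- No nonterminal expands to the empty string. Counting it as available for free lets prefixes,
-- suffixes and paddings be empty without special treatment.
Available : Collage A m → List A → Set
Available G w = w ≡ [] ⊎ ∃[ j ] lookup (expansions G) j ≡ w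

-- A single system serves all words of the list, so that they can share nonterminals; `m` bounds its
-- size.
Builds : ℕ → List (List A) → Set
Builds {A} m ws = ∃[ m′ ] (m′ ≤ m × Σ[ G ∈ Collage A m′ ] All (Available G) ws)

extend : ∀ {ws} (G : Collage A m) (ρ : Rule A (expansions G)) →
         All (Available G) ws → All (Available (G ▷ ρ)) (⟦ ρ ⟧ ∷ ws)
extend G ρ avs = inj₂ (zero , refl) ∷ All.map (Sum.map₂ λ (j , eq) → suc j , eq) avs

builds-char : ∀ {ws} (a : A) → Builds m ws → Builds (suc m) ([ a ] ∷ ws)
builds-char a (m′ , m′≤ , G , avs) = suc m′ , s≤s m′≤ , G ▷ char a , extend G (char a) avs

builds-⊆ : ∀ {ws vs : List (List A)} → All (_∈ ws) vs → Builds m ws → Builds m vs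
builds-⊆ vs∈ (m′ , m′≤ , G , avs) = m′ , m′≤ , G , All.map (All.lookup avs) vs∈

builds-∈ : ∀ {ws} {u : List A} → u ∈ ws → Builds m ws → Builds m (u ∷ ws)
builds-∈ u∈ b = builds-⊆ (u∈ ∷ All.tabulate id) b

builds-[] : ∀ {ws : List (List A)} → Builds m ws → Builds m ([] ∷ ws)
builds-[] (m′ , m′≤ , G , avs) = m′ , m′≤ , G , inj₁ refl ∷ avs

builds-≤ : ∀ {ws : List (List A)} → m ≤ n → Builds m ws → Builds n ws
builds-≤ m≤n (m′ , m′≤ , r) = m′ , ≤-trans m′≤ m≤n , r

builds-pair : ∀ {ws} {u v : List A} → u ∈ ws → v ∈ ws → Builds m ws → Builds (suc m) ((u ++ v) ∷ ws)
builds-pair {u = u} u∈ v∈ b@(m′ , m′≤ , G , avs) with All.lookup avs u∈ | All.lookup avs v∈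
... | inj₁ refl       | _               = builds-≤ (n≤1+n _) (builds-∈ v∈ b)
... | inj₂ _          | inj₁ refl       = builds-≤ (n≤1+n _) (builds-∈ (subst (_∈ _) (sym (++-identityʳ u)) u∈) b)
... | inj₂ (j , refl) | inj₂ (k , refl) = suc m′ , s≤s m′≤ , G ▷ pair j k , extend G (pair j k) avs

builds-take : ∀ {ws} {u : List A} k → u ∈ ws → Builds m ws → Builds (suc m) (take k u ∷ ws)
builds-take zero u∈ b = builds-≤ (n≤1+n _) (builds-[] b)
builds-take {u = u} (suc k) u∈ b@(m′ , m′≤ , G , avs) with suc k ≤? length u | All.lookup avs u∈
... | no k≰ | _ = builds-≤ (n≤1+n _) (builds-∈ (subst (_∈ _) (sym (take-all (suc k) u (≰⇒≥ k≰))) u∈) b)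
... | yes _  | inj₁ refl       = builds-≤ (n≤1+n _) (builds-[] b)
... | yes k< | inj₂ (j , refl) = suc m′ , s≤s m′≤ , G ▷ ρ , extend G ρ avs
  where ρ = substr j 0 k z≤n k<

builds-drop : ∀ {ws} {u : List A} k → u ∈ ws → Builds m ws → Builds (suc m) (drop k u ∷ ws)
builds-drop {u = u} k u∈ b@(m′ , m′≤ , G , avs) with k <? length u | All.lookup avs u∈
... | no k≮ | _ = builds-≤ (n≤1+n _) (subst (λ z → Builds _ (z ∷ _)) (sym (drop-all k u (≮⇒≥ k≮))) (builds-[] b))
... | yes k< | inj₁ refl with () ← k<
... | yes k< | inj₂ (j , refl) =
  suc m′ , s≤s m′≤ , G ▷ ρ , subst (λ z → All (Available (G ▷ ρ)) (z ∷ _)) slice (extend G ρ avs)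
  where
  |u| : suc (ℕ.pred (length u)) ≡ length u
  |u| = suc-pred (length u) {{ℕ.>-nonZero (≤-<-trans z≤n k<)}}
  ρ = substr j k (ℕ.pred (length u)) (<⇒≤pred k<) (≤-reflexive |u|)
  slice : u [ k ‥ ℕ.pred (length u) ] ≡ drop k u
  slice = take-all _ _ (≤-reflexive (trans (length-drop k u) (cong (_∸ k) (sym |u|))))

builds-word : ∀ {ws} (S : List A) → Builds m ws → Builds (length S * 2 + m) (S ∷ ws)
builds-word []      b = builds-[] b
builds-word (a ∷ S) b =
  builds-⊆ (here refl ∷ All.tabulate (there ∘ there ∘ there))
    (builds-pair (here refl) (there (here refl)) (builds-char a (builds-word S b)))

builds-concat : ∀ {ws us : List (List A)} → All (_∈ ws) us → Builds m ws → Builds (length us + m) (concat us ∷ ws)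
builds-concat []         b = builds-[] b
builds-concat (u∈ ∷ us∈) b =
  builds-⊆ (here refl ∷ All.tabulate (there ∘ there)) (builds-pair (there u∈) (here refl) (builds-concat us∈ b))

[a]^r : ∀ (a : A) r → [ a ] ^ r ≡ replicate r a
[a]^r a zero    = refl
[a]^r a (suc r) = cong (a ∷_) ([a]^r a r)

-- A power rule makes the cost independent of `r`. The exponents 0 and 1 are separate because the
-- rule demands `2 ≤ r`.
builds-replicate : ∀ {ws} r (a : A) → Builds m ws → Builds (2 + m) (replicate r a ∷ ws)
builds-replicate zero a b = builds-≤ (m≤n+m _ 2) (builds-[] b)
builds-replicate (suc zero) a b = builds-≤ (n≤1+n _) (builds-char a b)
builds-replicate (suc (suc r)) a b with builds-char a b
... | m′ , m′≤ , G , inj₂ (j , eq) ∷ avs =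
  suc m′ , s≤s m′≤ , G ▷ ρ , subst (λ z → All (Available (G ▷ ρ)) (z ∷ _)) spelled (extend G ρ avs)
  where
  ρ = power j (2 + r) (s≤s (s≤s z≤n))
  spelled = trans (cong (_^ (2 + r)) eq) ([a]^r a (2 + r))

-- The word may sit at any nonterminal, while the derived string belongs to the last one. One more
-- rule, taking the whole word as a substring, closes the gap.
builds⇒derives : ∀ {S : List A} → 1 ≤ length S → Builds m [ S ] →
                 ∃[ m′ ] (m′ ≤ suc m × Σ[ G ∈ Collage A m′ ] G Derives S)
builds⇒derives {S = a ∷ S} _ (m′ , m′≤ , G , inj₂ (j , eq) ∷ []) =
  suc m′ , s≤s m′≤ , G ▷ substr j 0 (length S) z≤n (≤-reflexive (cong length (sym eq))) ,
  trans (take-all _ _ (≤-reflexive (cong length eq))) eq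

-- The hard strings

Row : Set
Row = ℕ → Bool

-- The letters record their column, so equal letters can only occur in the same column.
word : ℕ → Row → List (ℕ × Bool)
word K ρ = applyUpTo (λ c → c , ρ c) K

infix 4 _≈[_]_

-- Rows are functions on all of `ℕ`, but only their first `K` columns are spelled.
_≈[_]_ : (ℕ → A) → ℕ → (ℕ → A) → Set
f ≈[ K ] g = ∀ c → c < K → f c ≡ g c

applyUpTo-cong : ∀ {f g : ℕ → A} K → f ≈[ K ] g → applyUpTo f K ≡ applyUpTo g K
applyUpTo-cong zero    f≈g = refl
applyUpTo-cong (suc K) f≈g = cong₂ _∷_ (f≈g 0 (s≤s z≤n)) (applyUpTo-cong K (λ c → f≈g (suc c) ∘ s≤s))

applyUpTo-update : ∀ {f g : ℕ → A} {c K} → c < K → (∀ {d} → d < K → d ≢ c → f d ≡ g d) →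
                   applyUpTo g K ≡ take c (applyUpTo f K) ++ [ g c ] ++ drop (suc c) (applyUpTo f K)
applyUpTo-update {g = g} {zero}  {suc K} _         same =
  cong (g 0 ∷_) (sym (applyUpTo-cong K (λ _ d< → same (s≤s d<) λ ())))
applyUpTo-update {g = g} {suc c} {suc K} (s≤s c<K) same =
  cong₂ _∷_ (sym (same (s≤s z≤n) λ ())) (applyUpTo-update c<K (λ d< d≢c → same (s≤s d<) (d≢c ∘ suc-injective)))

Adjacent : ℕ → Row → Row → Set
Adjacent K ρ σ = ∃[ c ] (c < K × ∀ {d} → d < K → d ≢ c → ρ d ≡ σ d)

data Steps (K : ℕ) (ρ σ : Row) : List Row → Set where
  []  : ρ ≈[ K ] σ → Steps K ρ σ []
  _∷_ : ∀ {ρ′ rs} → Adjacent K ρ ρ′ → Steps K ρ′ σ rs → Steps K ρ σ (ρ′ ∷ rs)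

Steps-≈ : ∀ {K ρ ρ′ σ rs} → ρ ≈[ K ] ρ′ → Steps K ρ′ σ rs → Steps K ρ σ rs
Steps-≈ eq ([] eq′)                   = [] (λ c c< → trans (eq c c<) (eq′ c c<))
Steps-≈ eq ((c , c<K , same) ∷ steps) = (c , c<K , λ {d} d< d≢ → trans (eq d d<) (same d< d≢)) ∷ steps

_++ˢ_ : ∀ {K ρ σ τ rs ss} → Steps K ρ σ rs → Steps K σ τ ss → Steps K ρ τ (rs ++ ss)
[] eq         ++ˢ steps′ = Steps-≈ eq steps′
(adj ∷ steps) ++ˢ steps′ = adj ∷ (steps ++ˢ steps′)

Steps-map : ∀ {K K′ ρ σ rs} (f : Row → Row) → (∀ {ρ σ} → ρ ≈[ K ] σ → f ρ ≈[ K′ ] f σ) →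
            (∀ {ρ σ} → Adjacent K ρ σ → Adjacent K′ (f ρ) (f σ)) →
            Steps K ρ σ rs → Steps K′ (f ρ) (f σ) (map f rs)
Steps-map f f-≈ f-adj ([] eq)       = [] (f-≈ eq)
Steps-map f f-≈ f-adj (adj ∷ steps) = f-adj adj ∷ Steps-map f f-≈ f-adj steps

Steps-≈ʳ : ∀ {K ρ σ σ′ rs} → σ ≈[ K ] σ′ → Steps K ρ σ rs → Steps K ρ σ′ rs
Steps-≈ʳ eq ([] eq′)      = [] (λ c c< → trans (eq′ c c<) (eq c c<))
Steps-≈ʳ eq (adj ∷ steps) = adj ∷ Steps-≈ʳ eq steps

last∈steps : ∀ {K ρ σ r rs} → Steps K ρ σ (r ∷ rs) → Any (σ ≈[ K ]_) (r ∷ rs)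
last∈steps (_ ∷ [] eq)             = here (λ c c< → sym (eq c c<))
last∈steps (_ ∷ steps@(_ ∷ _))     = there (last∈steps steps)

-- Five rules per row: the part before the changed column, the part after it, the new letter, and
-- two concatenations.
builds-steps : ∀ {K ρ σ rs ws} → Steps K ρ σ rs → word K ρ ∈ ws → Builds m ws →
               Builds (length rs * 5 + m) (map (word K) rs ++ ws)
builds-steps ([] _) _ b = b
builds-steps {m = m} {K} {ρ} {rs = ρ′ ∷ rs} {ws} ((c , c<K , same) ∷ steps) ρ∈ b =
  builds-≤ (≤-reflexive (trans (sym (+-assoc (length rs * 5) 5 m)) (cong (_+ m) (+-comm (length rs * 5) 5))))
    (builds-⊆ (All.++⁺ (∈-++⁺ʳ (map (word K) rs) (here refl) ∷ All.tabulate ∈-++⁺ˡ)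
                       (All.tabulate (∈-++⁺ʳ (map (word K) rs) ∘ there)))
      (builds-steps steps (here refl) updated))
  where
  pieces = builds-drop (suc c) (there ρ∈) (builds-take c ρ∈ b)
  glued  = builds-pair (here refl) (there (here refl)) (builds-char (c , ρ′ c) pieces)
  whole  = builds-pair (there (there (there (here refl)))) (here refl) glued
  updated : Builds (5 + m) (word K ρ′ ∷ ws)
  updated = builds-⊆ (here (applyUpTo-update c<K (λ {d} d< d≢ → cong (d ,_) (same d< d≢)))
                      ∷ All.tabulate (there ∘ there ∘ there ∘ there ∘ there)) whole

-- Interleaving of rows

interleave : Row → Row → Row
interleave ρ σ zero          = ρ 0
interleave ρ σ (suc zero)    = σ 0
interleave ρ σ (suc (suc c)) = interleave (ρ ∘ suc) (σ ∘ suc) c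

interleave-even : ∀ ρ σ x → interleave ρ σ (x + x) ≡ ρ x
interleave-even ρ σ zero    = refl
interleave-even ρ σ (suc x) rewrite +-suc x x = interleave-even (ρ ∘ suc) (σ ∘ suc) x

interleave-odd : ∀ ρ σ x → interleave ρ σ (suc (x + x)) ≡ σ x
interleave-odd ρ σ zero    = refl
interleave-odd ρ σ (suc x) rewrite +-suc x x = interleave-odd (ρ ∘ suc) (σ ∘ suc) x

interleave-const : ∀ b c → b ≡ interleave (const b) (const b) c
interleave-const b zero          = refl
interleave-const b (suc zero)    = refl
interleave-const b (suc (suc c)) = interleave-const b c

data Parity : ℕ → Set where
  even : ∀ x → Parity (x + x)
  odd  : ∀ x → Parity (suc (x + x))

parity : ∀ c → Parity c
parity zero = even 0
parity (suc c) with parity c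
... | even x = odd x
... | odd x  = subst Parity (cong suc (+-suc x x)) (even (suc x))

double-cancel-< : ∀ {x K} → x + x < K + K → x < K
double-cancel-< {x} {K} h with x <? K
... | yes x<K = x<K
... | no  x≮K = contradiction h (≤⇒≯ (+-mono-≤ (≮⇒≥ x≮K) (≮⇒≥ x≮K)))

suc-double-< : ∀ {x K} → x < K → suc (x + x) < K + K
suc-double-< {x} {K} x<K = subst (_≤ K + K) (cong suc (+-suc x x)) (+-mono-≤ x<K x<K)

interleave-≈ : ∀ {K ρ ρ′ σ σ′} → ρ ≈[ K ] ρ′ → σ ≈[ K ] σ′ → interleave ρ σ ≈[ K + K ] interleave ρ′ σ′
interleave-≈ {ρ = ρ} {ρ′} {σ} {σ′} p q c c< with parity c
... | even x = trans (interleave-even ρ σ x) (trans (p x (double-cancel-< c<)) (sym (interleave-even ρ′ σ′ x)))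
... | odd x  = trans (interleave-odd ρ σ x)
  (trans (q x (double-cancel-< (<-trans (n<1+n _) c<))) (sym (interleave-odd ρ′ σ′ x)))

adjacent-evens : ∀ {K ρ ρ′} σ → Adjacent K ρ ρ′ → Adjacent (K + K) (interleave ρ σ) (interleave ρ′ σ)
adjacent-evens {K} {ρ} {ρ′} σ (c , c<K , same) = c + c , +-mono-< c<K c<K , go
  where
  go : ∀ {d} → d < K + K → d ≢ c + c → interleave ρ σ d ≡ interleave ρ′ σ d
  go {d} d< d≢ with parity d
  ... | even x = trans (interleave-even ρ σ x)
    (trans (same (double-cancel-< d<) λ {refl → d≢ refl}) (sym (interleave-even ρ′ σ x)))
  ... | odd x  = trans (interleave-odd ρ σ x) (sym (interleave-odd ρ′ σ x))

adjacent-odds : ∀ {K σ σ′} ρ → Adjacent K σ σ′ → Adjacent (K + K) (interleave ρ σ) (interleave ρ σ′)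
adjacent-odds {K} {σ} {σ′} ρ (c , c<K , same) = suc (c + c) , suc-double-< c<K , go
  where
  go : ∀ {d} → d < K + K → d ≢ suc (c + c) → interleave ρ σ d ≡ interleave ρ σ′ d
  go {d} d< d≢ with parity d
  ... | even x = trans (interleave-even ρ σ x) (sym (interleave-even ρ σ′ x))
  ... | odd x  = trans (interleave-odd ρ σ x)
    (trans (same (double-cancel-< (<-trans (n<1+n _) d<)) λ {refl → d≢ refl}) (sym (interleave-odd ρ σ′ x)))

-- The marking history and its rows in binary search order

off on : Row
off = const false
on  = const true

2^ : ℕ → ℕ
2^ zero    = 1
2^ (suc M) = 2^ M + 2^ M

2^-pos : ∀ M → 1 ≤ 2^ M
2^-pos zero    = ≤-refl
2^-pos (suc M) = ≤-trans (2^-pos M) (m≤m+n _ _)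

-- Rows in order of time, without the initial unmarked one. The first half of the time marks the
-- even columns and the second half the odd ones: the lowest bit of a column is the highest bit of
-- its time, which is the bit-reversed order.
history : ℕ → List Row
history zero    = [ on ]
history (suc M) = map (λ ρ → interleave ρ off) (history M) ++ map (interleave on) (history M)

length-history : ∀ M → length (history M) ≡ 2^ M
length-history zero    = refl
length-history (suc M) = trans (length-++ (map _ (history M)))
  (cong₂ _+_ (trans (length-map _ (history M)) (length-history M))
             (trans (length-map _ (history M)) (length-history M)))

freezeOdds freezeEvens : Row → Row
freezeOdds ρ  = interleave ρ off
freezeEvens ρ = interleave on ρ

steps-history : ∀ M → Steps (2^ M) off on (history M)
steps-history zero    = (0 , s≤s z≤n , λ { (s≤s z≤n) d≢0 → contradiction refl d≢0 }) ∷ [] (λ _ _ → refl)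
steps-history (suc M) =
  Steps-≈ (λ c _ → interleave-const false c) (Steps-≈ʳ (λ c _ → sym (interleave-const true c))
    (Steps-map freezeOdds (λ p → interleave-≈ p λ _ _ → refl) (adjacent-evens off) ih ++ˢ
     Steps-map freezeEvens (interleave-≈ λ _ _ → refl) (adjacent-odds on) ih))
  where ih = steps-history M

-- (x , d) stands for the two places x and x + d.
Window : Set
Window = ℕ × ℕ

-- Consecutive windows may share an endpoint: each will force a phrase boundary `e` with
-- `x < e ≤ x + d`, and these half-open intervals are disjoint.
data Spread (hi : ℕ) : ℕ → List Window → Set where
  []  : ∀ {lo} → Spread hi lo []
  win : ∀ {lo x d ws} → lo ≤ x → 1 ≤ d → x + d < hi → Spread hi (x + d) ws → Spread hi lo ((x , d) ∷ ws)

Marked : Row → Window → Set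
Marked ρ (x , d) = ρ x ≡ true × ρ (x + d) ≡ false

MarkedRow : Set
MarkedRow = Row × List Window

evenWindow oddWindow : Window → Window
evenWindow (x , d) = x + x , d + d
oddWindow  (x , d) = suc (x + x) , d + d

evens odds : MarkedRow → MarkedRow
evens (ρ , ws) = freezeOdds ρ , map evenWindow ws
odds  (ρ , ws) = freezeEvens ρ , map oddWindow ws

-- The state at half time. Each window pairs a marked even column with the unmarked one to its
-- right.
alternating : ℕ → MarkedRow
alternating K = interleave on off , applyUpTo (λ i → i + i , 1) K

-- Preorder of the binary search over time: the middle row, then the rows of the first half, then
-- those of the second.
rows : ℕ → List MarkedRow
rows zero    = []
rows (suc M) = alternating (2^ M) ∷ map evens (rows M) ++ map odds (rows M)

Good : ℕ → MarkedRow → Set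
Good K (ρ , ws) = Spread K 0 ws × All (Marked ρ) ws

Separated : MarkedRow → MarkedRow → Set
Separated (ρ′ , _) (_ , ws) = All (λ w → ¬ Marked ρ′ w) ws

spread-lower : ∀ {hi lo lo′ ws} → lo′ ≤ lo → Spread hi lo ws → Spread hi lo′ ws
spread-lower lo′≤ []                 = []
spread-lower lo′≤ (win lo≤ 1≤ <hi s) = win (≤-trans lo′≤ lo≤) 1≤ <hi s

double-+ : ∀ x d → (x + d) + (x + d) ≡ (x + x) + (d + d)
double-+ = solve-∀

spread-evens : ∀ {K lo ws} → Spread K lo ws → Spread (K + K) (lo + lo) (map evenWindow ws)
spread-evens [] = []
spread-evens {K} (win {x = x} {d} {ws} lo≤ 1≤ <hi s) =
  win (+-mono-≤ lo≤ lo≤) (≤-trans 1≤ (m≤m+n d d)) (subst (_< K + K) (double-+ x d) (+-mono-< <hi <hi))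
      (subst (λ z → Spread (K + K) z (map evenWindow ws)) (double-+ x d) (spread-evens s))

spread-odds : ∀ {K lo ws} → Spread K lo ws → Spread (K + K) (suc (lo + lo)) (map oddWindow ws)
spread-odds [] = []
spread-odds {K} (win {x = x} {d} {ws} lo≤ 1≤ <hi s) =
  win (s≤s (+-mono-≤ lo≤ lo≤)) (≤-trans 1≤ (m≤m+n d d))
      (subst (λ z → suc z < K + K) (double-+ x d) (suc-double-< <hi))
      (subst (λ z → Spread (K + K) (suc z) (map oddWindow ws)) (double-+ x d) (spread-odds s))

-- The offset `a` carries the induction, since removing the first window shifts the index of the
-- others. The windows of `alternating` are the case `a = 0`.
spread-alternating : ∀ k a → Spread ((a + k) + (a + k)) (a + a) (applyUpTo (λ i → (a + i) + (a + i) , 1) k)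
spread-alternating zero    a = []
spread-alternating (suc k) a =
  win (≤-reflexive (sym (cong₂ _+_ a0 a0))) ≤-refl
      (subst (_< (a + suc k) + (a + suc k)) (sym (+-comm _ 1)) (suc-double-< (+-monoʳ-< a (s≤s z≤n))))
      (spread-lower lower rest)
  where
  a0 = +-identityʳ a
  lower : a + 0 + (a + 0) + 1 ≤ suc a + suc a
  lower = subst₂ _≤_ (sym (trans (cong (_+ 1) (cong₂ _+_ a0 a0)) (+-comm (a + a) 1)))
                     (sym (cong suc (+-suc a a))) (n≤1+n _)
  rest : Spread ((a + suc k) + (a + suc k)) (suc a + suc a) (applyUpTo (λ i → (a + suc i) + (a + suc i) , 1) k)
  rest = subst₂ (λ z ws → Spread (z + z) (suc a + suc a) ws) (sym (+-suc a k))
    (applyUpTo-cong k λ i _ → cong (λ z → z + z , 1) (sym (+-suc a i))) (spread-alternating k (suc a))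

good-alternating : ∀ K → Good (K + K) (alternating K)
good-alternating K = spread-alternating K 0 , All.applyUpTo⁺₁ _ K λ {i} _ →
  interleave-even on off i , subst (λ z → interleave on off z ≡ false) (+-comm 1 (i + i)) (interleave-odd on off i)

marked-even : ∀ ρ σ w → Marked (interleave ρ σ) (evenWindow w) → Marked ρ w
marked-even ρ σ (x , d) (p , q) = trans (sym (interleave-even ρ σ x)) p ,
  trans (sym (interleave-even ρ σ (x + d))) (subst (λ z → interleave ρ σ z ≡ false) (sym (double-+ x d)) q)

marked-even⁺ : ∀ ρ σ w → Marked ρ w → Marked (interleave ρ σ) (evenWindow w)
marked-even⁺ ρ σ (x , d) (p , q) = trans (interleave-even ρ σ x) p ,
  subst (λ z → interleave ρ σ z ≡ false) (double-+ x d) (trans (interleave-even ρ σ (x + d)) q)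

marked-odd : ∀ ρ σ w → Marked (interleave ρ σ) (oddWindow w) → Marked σ w
marked-odd ρ σ (x , d) (p , q) = trans (sym (interleave-odd ρ σ x)) p ,
  trans (sym (interleave-odd ρ σ (x + d))) (subst (λ z → interleave ρ σ (suc z) ≡ false) (sym (double-+ x d)) q)

marked-odd⁺ : ∀ ρ σ w → Marked σ w → Marked (interleave ρ σ) (oddWindow w)
marked-odd⁺ ρ σ (x , d) (p , q) = trans (interleave-odd ρ σ x) p ,
  subst (λ z → interleave ρ σ (suc z) ≡ false) (double-+ x d) (trans (interleave-odd ρ σ (x + d)) q)

good-rows : ∀ M → All (Good (2^ M)) (rows M)
good-rows zero    = []
good-rows (suc M) = good-alternating (2^ M) ∷ All.++⁺
  (All.map⁺ (All.map (λ {r} → good-even r) (good-rows M)))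
  (All.map⁺ (All.map (λ {r} → good-odd r) (good-rows M)))
  where
  good-even : ∀ r → Good (2^ M) r → Good (2^ M + 2^ M) (evens r)
  good-even (ρ , _) (sp , mk) = spread-evens sp , All.map⁺ (All.map (λ {w} → marked-even⁺ ρ off w) mk)
  good-odd : ∀ r → Good (2^ M) r → Good (2^ M + 2^ M) (odds r)
  good-odd (ρ , _) (sp , mk) = spread-lower z≤n (spread-odds sp) , All.map⁺ (All.map (λ {w} → marked-odd⁺ on ρ w) mk)

separated-evens : ∀ r′ r → Separated r′ r → Separated (evens r′) (evens r)
separated-evens (ρ′ , _) _ sep = All.map⁺ (All.map (λ {w} ¬mk → ¬mk ∘ marked-even ρ′ off w) sep)

separated-odds : ∀ r′ r → Separated r′ r → Separated (odds r′) (odds r)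
separated-odds (ρ′ , _) _ sep = All.map⁺ (All.map (λ {w} ¬mk → ¬mk ∘ marked-odd on ρ′ w) sep)

-- The even columns of the middle row are all marked, so the right end of an even window is never
-- unmarked there.
separated-alternating-evens : ∀ K r → Separated (alternating K) (evens r)
separated-alternating-evens K r = All.map⁺ (All.tabulate λ {w} _ mk →
  contradiction (proj₂ (marked-even on off w mk)) λ ())

-- As long as the odd columns are off, the left end of an odd window is unmarked.
separated-odd-column : ∀ ρ r → Separated (interleave ρ off , []) (odds r)
separated-odd-column ρ r = All.map⁺ (All.tabulate λ {w} _ mk →
  contradiction (proj₁ (marked-odd ρ off w mk)) λ ())

-- The middle row shows no window of either half. A row of the first half precedes all rows of the
-- second and leaves the odd columns off. Within a half the claim is inherited.
separated-rows : ∀ M → AllPairs Separated (rows M)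
separated-rows zero    = []
separated-rows (suc M) =
  All.++⁺ (All.map⁺ {xs = rows M} (All.tabulate λ {r} _ → separated-alternating-evens (2^ M) r))
          (All.map⁺ {xs = rows M} (All.tabulate λ {r} _ → separated-odd-column on r))
  ∷ AllPairs.++⁺
      (AllPairs.map⁺ (AllPairs.map (λ {r′} {r} → separated-evens r′ r) (separated-rows M)))
      (AllPairs.map⁺ (AllPairs.map (λ {r′} {r} → separated-odds r′ r) (separated-rows M)))
      (All.map⁺ (All.tabulate λ {r′} _ → All.map⁺ (All.tabulate λ {r} _ → separated-odd-column (proj₁ r′) r)))

-- Counting rows and windows

totalWindows : List MarkedRow → ℕ
totalWindows rs = sum (map (length ∘ proj₂) rs)

length-rows : ∀ M → suc (length (rows M)) ≡ 2^ M
length-rows zero    = refl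
length-rows (suc M) = begin
  2 + length (map evens (rows M) ++ map odds (rows M))  ≡⟨ cong (2 +_) (length-++ (map evens (rows M))) ⟩
  2 + (length (map evens (rows M)) + length (map odds (rows M)))
    ≡⟨ cong (2 +_) (cong₂ _+_ (length-map evens (rows M)) (length-map odds (rows M))) ⟩
  2 + (length (rows M) + length (rows M))                ≡⟨ cong suc (+-suc _ _) ⟨
  suc (length (rows M)) + suc (length (rows M))          ≡⟨ cong₂ _+_ (length-rows M) (length-rows M) ⟩
  2^ M + 2^ M                                            ∎
  where open ≡-Reasoning

totalWindows-++ : ∀ rs ss → totalWindows (rs ++ ss) ≡ totalWindows rs + totalWindows ss
totalWindows-++ []       ss = refl
totalWindows-++ (r ∷ rs) ss =
  trans (cong (length (proj₂ r) +_) (totalWindows-++ rs ss)) (sym (+-assoc (length (proj₂ r)) _ _))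

totalWindows-map : ∀ (f : MarkedRow → MarkedRow) → (∀ r → length (proj₂ (f r)) ≡ length (proj₂ r)) →
                   ∀ rs → totalWindows (map f rs) ≡ totalWindows rs
totalWindows-map f same []       = refl
totalWindows-map f same (r ∷ rs) = cong₂ _+_ (same r) (totalWindows-map f same rs)

-- The number of windows satisfies W(M + 1) = 2^M + 2 W(M). The doubled form keeps halves out.
totalWindows-rows : ∀ M → totalWindows (rows M) + totalWindows (rows M) ≡ M * 2^ M
totalWindows-rows zero    = refl
totalWindows-rows (suc M) = begin
  t + t                      ≡⟨ cong₂ _+_ unfold unfold ⟩
  (K + (W + W)) + (K + (W + W)) ≡⟨ cong (λ z → (K + z) + (K + z)) (totalWindows-rows M) ⟩
  (K + M * K) + (K + M * K)  ≡⟨ rearrange M K ⟩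
  suc M * (K + K)            ∎
  where
  open ≡-Reasoning
  K = 2^ M
  W = totalWindows (rows M)
  t = totalWindows (rows (suc M))
  rearrange : ∀ M K → (K + M * K) + (K + M * K) ≡ suc M * (K + K)
  rearrange = solve-∀
  unfold : t ≡ K + (W + W)
  unfold = cong₂ _+_ (length-applyUpTo (λ i → i + i , 1) K)
    (trans (totalWindows-++ (map evens (rows M)) _)
      (cong₂ _+_ (totalWindows-map evens (λ r → length-map evenWindow (proj₂ r)) (rows M))
                 (totalWindows-map odds (λ r → length-map oddWindow (proj₂ r)) (rows M))))

-- This links the two orders, by time and by binary search, so that every row to be concatenated has
-- been built. The middle row comes from the fully marked last row of the smaller history.
rows⊆history : ∀ M → All (λ r → Any (proj₁ r ≈[ 2^ M ]_) (history M)) (rows M)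
rows⊆history zero    = []
rows⊆history (suc M) = evensFrom finished ∷ All.++⁺
  (All.map⁺ (All.map evensFrom (rows⊆history M)))
  (All.map⁺ (All.map oddsFrom (rows⊆history M)))
  where
  evensFrom : ∀ {ρ} → Any (ρ ≈[ 2^ M ]_) (history M) → Any (freezeOdds ρ ≈[ 2^ (suc M) ]_) (history (suc M))
  evensFrom ρ∈ = Any.++⁺ˡ (Any.map⁺ (Any.map (λ p → interleave-≈ p λ _ _ → refl) ρ∈))
  oddsFrom : ∀ {ρ} → Any (ρ ≈[ 2^ M ]_) (history M) → Any (freezeEvens ρ ≈[ 2^ (suc M) ]_) (history (suc M))
  oddsFrom ρ∈ = Any.++⁺ʳ (map freezeOdds (history M)) (Any.map⁺ (Any.map (interleave-≈ λ _ _ → refl) ρ∈))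
  finished : Any (on ≈[ 2^ M ]_) (history M)
  finished with history M | steps-history M | length-history M
  ... | []    | _     | eq = contradiction (subst (1 ≤_) (sym eq) (2^-pos M)) λ ()
  ... | _ ∷ _ | steps | _  = last∈steps steps

-- Phrases forced by unseen windows

at : List A → ℕ → Maybe A
at []       _       = nothing
at (x ∷ _)  zero    = just x
at (_ ∷ xs) (suc p) = at xs p

at-++ˡ : ∀ (X : List A) {Y p} → p < length X → at (X ++ Y) p ≡ at X p
at-++ˡ (x ∷ X) {p = zero}  _       = refl
at-++ˡ (x ∷ X) {p = suc p} (s≤s h) = at-++ˡ X h

at-++ʳ : ∀ (X : List A) {Y} p → at (X ++ Y) (length X + p) ≡ at Y p
at-++ʳ []      p = refl
at-++ʳ (x ∷ X) p = at-++ʳ X p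

at-drop : ∀ b (S : List A) p → at (drop b S) p ≡ at S (b + p)
at-drop zero    S       p = refl
at-drop (suc b) []      p = refl
at-drop (suc b) (x ∷ S) p = at-drop b S p

at-applyUpTo : ∀ (f : ℕ → A) {K p} → p < K → at (applyUpTo f K) p ≡ just (f p)
at-applyUpTo f {suc K} {zero}  _       = refl
at-applyUpTo f {suc K} {suc p} (s≤s h) = at-applyUpTo (f ∘ suc) h

-- Only the letters at the two ends are compared, which already rules out copying a phrase that
-- contains both.
Unseen : List A → Window → Set
Unseen S (u , d) = ∀ p → p < u → at S p ≡ at S u → at S (p + d) ≡ at S (u + d) → ⊥

-- A fresh phrase is a single letter and cannot contain two ends at distance `d ≥ 1`. A copied
-- phrase would show both end letters at its source, from `length pre + (u ∸ b) < u` on.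
phrase-misses : ∀ {S : List A} {b U F T u d} → LZPhrase S b U F → U ≡ F ++ T → drop b S ≡ U →
                b ≤ u → 1 ≤ d → u + d < b + length F → ¬ Unseen S (u , d)
phrase-misses {b = b} {u = u} {d} (fresh _) _ _ b≤u 1≤d <end _ =
  <⇒≱ <end (subst (_≤ u + d) (refl {x = b + 1}) (+-mono-≤ b≤u 1≤d))
phrase-misses {S = S} {b} {_} {F} {T} {u} {d} (copy _ (_ , (pre , post , pre<b , eq) , _))
              spelt dropS b≤u 1≤d <end unseen =
  unseen (length pre + i) p<u (copied (+-cancelˡ-< b _ _ i<)) copied-end
  where
  i = u ∸ b
  b+i : b + i ≡ u
  b+i = m+[n∸m]≡n b≤u
  p<u : length pre + i < u
  p<u = subst (length pre + i <_) b+i (+-monoˡ-< i pre<b)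
  i< : b + i < b + length F
  i< = subst (_< b + length F) (sym b+i) (≤-<-trans (m≤m+n u d) <end)
  copied′ : ∀ j → j < length F → at S (length pre + j) ≡ at S (b + j)
  copied′ j j<F = begin
    at S (length pre + j)                   ≡⟨ cong (λ z → at z (length pre + j)) eq ⟩
    at (pre ++ F ++ post) (length pre + j)  ≡⟨ at-++ʳ pre j ⟩
    at (F ++ post) j                        ≡⟨ at-++ˡ F j<F ⟩
    at F j                                  ≡⟨ at-++ˡ F j<F ⟨
    at (F ++ T) j                           ≡⟨ cong (λ z → at z j) (trans dropS spelt) ⟨
    at (drop b S) j                         ≡⟨ at-drop b S j ⟩
    at S (b + j)                            ∎
    where open ≡-Reasoning
  copied : i < length F → at S (length pre + i) ≡ at S u
  copied h = trans (copied′ i h) (cong (at S) b+i)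
  b+[i+d] : b + (i + d) ≡ u + d
  b+[i+d] = trans (sym (+-assoc b i d)) (cong (_+ d) b+i)
  copied-end : at S (length pre + i + d) ≡ at S (u + d)
  copied-end = trans (cong (at S) (+-assoc (length pre) i d))
    (trans (copied′ (i + d) (+-cancelˡ-< b _ _ (subst (_< b + length F) (sym b+[i+d]) <end))) (cong (at S) b+[i+d]))

-- Let `e` be the end of the first phrase. If `e ≤ u`, the phrase is skipped; if `u < e ≤ u + d`, it
-- pays for the window; `e > u + d` is impossible, as the phrase would contain both ends.
windows≤phrases : ∀ {S : List A} {b T Fs lo ws} → LZFrom S b T Fs → drop b S ≡ T → b ≤ length S → b ≤ lo →
                  Spread (length S) lo ws → All (Unseen S) ws → length ws ≤ length Fs
windows≤phrases _ _ _ _ [] [] = z≤n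
windows≤phrases {S = S} {b} [] dropS b≤ b≤lo (win {x = u} {d} lo≤ _ <hi _) _ =
  contradiction (trans (sym (length-drop b S)) (cong length dropS))
    (<⇒≢ (m<n⇒0<n∸m (≤-<-trans (≤-trans b≤lo (≤-trans lo≤ (m≤m+n u d))) <hi)) ∘ sym)
windows≤phrases {S = S} {b} (_∷_ {F = F} {T = T} ph lz) dropS b≤ b≤lo
                (win {x = u} {d} lo≤ 1≤d <hi sp) (un ∷ uns)
  with b + length F ≤? u | b + length F ≤? u + d
... | yes end≤ | _        = ≤-trans
  (windows≤phrases lz (next-drop {b = b} {F} {T} dropS) (next-≤ {b = b} {F} {T} dropS b≤) end≤
    (win ≤-refl 1≤d <hi sp) (un ∷ uns))
  (n≤1+n _)
... | no _     | yes end≤ =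
  s≤s (windows≤phrases lz (next-drop {b = b} {F} {T} dropS) (next-≤ {b = b} {F} {T} dropS b≤) end≤ sp uns)
... | no _     | no end≰  =
  contradiction un (phrase-misses {T = T} ph refl dropS (≤-trans b≤lo lo≤) 1≤d (≰⇒> end≰))

-- Windows in the concatenated rows

module _ (K : ℕ) where

  rowWord : MarkedRow → List (ℕ × Bool)
  rowWord (ρ , _) = word K ρ

  spell : List MarkedRow → List (ℕ × Bool)
  spell rs = concat (map rowWord rs)

  shift : ℕ → Window → Window
  shift base (x , d) = base + x , d

  placed : ℕ → List MarkedRow → List Window
  placed base []              = []
  placed base ((ρ , ws) ∷ rs) = map (shift base) ws ++ placed (base + K) rs

  length-placed : ∀ base rs → length (placed base rs) ≡ totalWindows rs
  length-placed base []              = refl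
  length-placed base ((ρ , ws) ∷ rs) = trans (length-++ (map (shift base) ws))
    (cong₂ _+_ (length-map _ ws) (length-placed (base + K) rs))

  length-word : ∀ ρ → length (word K ρ) ≡ K
  length-word ρ = length-applyUpTo _ K

  length-spell : ∀ rs → length (spell rs) ≡ length rs * K
  length-spell []       = refl
  length-spell (r ∷ rs) = trans (length-++ (rowWord r)) (cong₂ _+_ (length-word (proj₁ r)) (length-spell rs))

  -- `Z` is whatever follows `B`, because `p + d` may lie past the end of `B`.
  Avoids : List (ℕ × Bool) → Window → Set
  Avoids B (x , d) = ∀ Z p → p < length B →
    at (B ++ Z) p ≡ just (x , true) → at (B ++ Z) (p + d) ≡ just (x + d , false) → ⊥

  at-row : ∀ ρ B Z {c} → c < K → at (B ++ word K ρ ++ Z) (length B + c) ≡ just (c , ρ c)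
  at-row ρ B Z {c} c<K = trans (at-++ʳ B c)
    (trans (at-++ˡ (word K ρ) (subst (c <_) (sym (length-word ρ)) c<K)) (at-applyUpTo _ c<K))

  column : ∀ ρ B Z {c x b} → c < K → at (B ++ word K ρ ++ Z) (length B + c) ≡ just (x , b) → c ≡ x × ρ c ≡ b
  column ρ B Z c<K eq with refl ← just-injective (trans (sym (at-row ρ B Z c<K)) eq) = refl , refl

  -- A match that starts in the new row starts in column `x`, as letters record their column. Its
  -- second place is then column `x + d` of the same row, contrary to `¬ Marked`.
  avoids-row : ∀ ρ′ B {x d} → x + d < K → ¬ Marked ρ′ (x , d) →
               Avoids B (x , d) → Avoids (B ++ word K ρ′) (x , d)
  avoids-row ρ′ B {x} {d} <K ¬mk av Z p p< p≡ pd≡ rewrite ++-assoc B (word K ρ′) Z with p <? length B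
  ... | yes p<B = av (word K ρ′ ++ Z) p p<B p≡ pd≡
  ... | no  p≮B = clash (column ρ′ B Z c<K (trans (cong (at S) eq) p≡))
    where
    c = p ∸ length B
    S = B ++ word K ρ′ ++ Z
    eq : length B + c ≡ p
    eq = m+[n∸m]≡n (≮⇒≥ p≮B)
    c<K : c < K
    c<K = +-cancelˡ-< (length B) _ _
      (subst₂ _<_ (sym eq) (trans (length-++ B) (cong (length B +_) (length-word ρ′))) p<)
    clash : c ≡ x × ρ′ c ≡ true → ⊥
    clash (refl , ρx) = ¬mk (ρx , proj₂ (column ρ′ B Z <K
      (trans (cong (at S) (trans (sym (+-assoc (length B) c d)) (cong (_+ d) eq))) pd≡)))

  -- A match that starts in `B` is excluded by `Avoids`. One that starts in the row itself would
  -- have to start in column `x`, hence not earlier than the window.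
  unseen-row : ∀ ρ B {Z w} → proj₁ w + proj₂ w < K → Marked ρ w → Avoids B w →
               Unseen (B ++ word K ρ ++ Z) (shift (length B) w)
  unseen-row ρ B {Z} {x , d} <K (ρx , ρxd) av p p<u p≡ pd≡ with p <? length B
  ... | yes p<B = av (word K ρ ++ Z) p p<B
    (trans p≡ (trans (at-row ρ B Z (≤-<-trans (m≤m+n x d) <K)) (cong (λ z → just (x , z)) ρx)))
    (trans pd≡ (trans (cong (at (B ++ word K ρ ++ Z)) (+-assoc (length B) x d))
                      (trans (at-row ρ B Z <K) (cong (λ z → just (x + d , z)) ρxd))))
  ... | no  p≮B = <⇒≢ c<x (proj₁ (column ρ B Z (<-trans c<x x<K)
                    (trans (cong (at S) eq) (trans p≡ (at-row ρ B Z x<K)))))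
    where
    x<K = ≤-<-trans (m≤m+n x d) <K
    c = p ∸ length B
    S = B ++ word K ρ ++ Z
    eq : length B + c ≡ p
    eq = m+[n∸m]≡n (≮⇒≥ p≮B)
    c<x : c < x
    c<x = +-cancelˡ-< (length B) _ _ (subst (_< length B + x) (sym eq) p<u)

  spread-end : ∀ {lo ws} → Spread K lo ws → All (λ w → proj₁ w + proj₂ w < K) ws
  spread-end []                = []
  spread-end (win _ _ <hi sp) = <hi ∷ spread-end sp

  spread-placed : ∀ {hi lo base ws} vs → base + K ≤ hi → Spread K lo ws → lo ≤ K → Spread hi (base + K) vs →
                  Spread hi (base + lo) (map (shift base) ws ++ vs)
  spread-placed {base = base} vs end≤ [] lo≤K sp′ = spread-lower (+-monoʳ-≤ base lo≤K) sp′
  spread-placed {hi} {base = base} vs end≤ (win {x = x} {d} {ws} lo≤ 1≤d <K sp) _ sp′ =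
    win (+-monoʳ-≤ base lo≤) 1≤d (subst (_< hi) (sym assoc) (<-≤-trans (+-monoʳ-< base <K) end≤))
        (subst (λ z → Spread hi z (map (shift base) ws ++ vs)) (sym assoc) (spread-placed vs end≤ sp (<⇒≤ <K) sp′))
    where assoc = +-assoc base x d

  spread-spell : ∀ {hi} base rs → All (Good K) rs → base + length rs * K ≤ hi → Spread hi base (placed base rs)
  spread-spell base []       []               _    = []
  spread-spell {hi} base (r ∷ rs) ((sp , _) ∷ good) end≤ =
    subst (λ z → Spread hi z (placed base (r ∷ rs))) (+-identityʳ base)
      (spread-placed (placed (base + K) rs) (≤-trans (m≤m+n (base + K) (length rs * K)) end′≤) sp z≤n
        (spread-spell (base + K) rs good end′≤))
    where
    end′≤ : base + K + length rs * K ≤ hi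
    end′≤ = subst (_≤ hi) (sym (+-assoc base K _)) end≤

  -- `B` collects the rows already spelled, and `Z` is the text after the last row. The invariant
  -- that `B` avoids all windows still to come is extended row by row through `Separated`.
  unseen-spell : ∀ B rs Z → AllPairs Separated rs → All (Good K) rs → All (λ r → All (Avoids B) (proj₂ r)) rs →
                 All (Unseen (B ++ spell rs ++ Z)) (placed (length B) rs)
  unseen-spell B []             Z []            []                 []         = []
  unseen-spell B ((ρ , ws) ∷ rs) Z (sep ∷ seps) ((sp , mk) ∷ good) (av ∷ avs) =
    All.++⁺ (All.map⁺ (All.zipWith first (spread-end sp , All.zip (mk , av))))
      (subst₂ (λ S base → All (Unseen S) (placed base rs))
        respell (trans (length-++ B) (cong (length B +_) (length-word ρ)))
        (unseen-spell (B ++ word K ρ) rs Z seps good (All.zipWith later (sep , All.zip (good , avs)))))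
    where
    first : ∀ {w} → proj₁ w + proj₂ w < K × Marked ρ w × Avoids B w →
            Unseen (B ++ (word K ρ ++ spell rs) ++ Z) (shift (length B) w)
    first {w} (<K , mk , av) = subst (λ z → Unseen (B ++ z) (shift (length B) w))
      (sym (++-assoc (word K ρ) (spell rs) Z)) (unseen-row ρ B {spell rs ++ Z} {w} <K mk av)
    later : ∀ {r} → Separated (ρ , ws) r × Good K r × All (Avoids B) (proj₂ r) →
            All (Avoids (B ++ word K ρ)) (proj₂ r)
    later (sep , (sp , _) , av) =
      All.zipWith (λ (¬mk , <K , av) → avoids-row ρ B <K ¬mk av) (sep , All.zip (spread-end sp , av))
    respell : (B ++ word K ρ) ++ spell rs ++ Z ≡ B ++ (word K ρ ++ spell rs) ++ Z
    respell = trans (++-assoc B (word K ρ) _) (cong (B ++_) (sym (++-assoc (word K ρ) (spell rs) Z)))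

-- Existence of the extremal quantities

-- The list contains every candidate that can beat `q`. If its head satisfies `P` and beats `q`, it
-- replaces `q`; otherwise it is struck off. This case distinction on an undecided `P` is why the
-- result is doubly negated.
¬¬maximal : {X : Set ℓ₁} (_<′_ : X → X → Set ℓ₂) → Transitive _<′_ → (∀ {x} → ¬ (x <′ x)) →
            (P : X → Set ℓ₃) (xs : List X) {q : X} → P q → (∀ r → P r → q <′ r → r ∈ xs) →
            ¬ ¬ (∃[ q ] (P q × ∀ r → P r → ¬ (q <′ r)))
¬¬maximal _<′_ <-tr <-irr P []       {q} Pq above k =
  k (q , Pq , λ r Pr q<r → contradiction (above r Pr q<r) λ ())
¬¬maximal _<′_ <-tr <-irr P (x ∷ xs) {q} Pq above k = unbeaten λ (Px , q<x) →
  ¬¬maximal _<′_ <-tr <-irr P xs Px (λ r Pr x<r → later x<r (above r Pr (<-tr q<x x<r))) k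
  where
  unbeaten : ¬ ¬ (P x × q <′ x)
  unbeaten ¬x = ¬¬maximal _<′_ <-tr <-irr P xs Pq (λ r Pr q<r → skip Pr q<r (above r Pr q<r)) k
    where
    skip : ∀ {r} → P r → q <′ r → r ∈ x ∷ xs → r ∈ xs
    skip Pr q<r (here refl) = contradiction (Pr , q<r) ¬x
    skip Pr q<r (there r∈)  = r∈
  later : ∀ {r} → x <′ r → r ∈ x ∷ xs → r ∈ xs
  later x<x (here refl) = contradiction x<x <-irr
  later _   (there r∈)  = r∈

prefix-take : ∀ {F T : List A} → Prefix _≡_ F T → take (length F) T ≡ F
prefix-take []         = refl
prefix-take (refl ∷ p) = cong (_ ∷_) (prefix-take p)

prefix-split : ∀ {F T : List A} → Prefix _≡_ F T → ∃[ T′ ] T ≡ F ++ T′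
prefix-split []         = _ , refl
prefix-split (refl ∷ p) = _ , cong (_ ∷_) (proj₂ (prefix-split p))

-- Without decidable equality of letters, neither the test for an earlier occurrence nor the choice
-- of a longest one is effective. The fuel bounds the remaining text, which shrinks with each
-- phrase.
¬¬lz : ∀ (S : List A) b T → ¬ ¬ (∃[ Fs ] LZFrom S b T Fs)
¬¬lz {A} S b T = go (length T) b T ≤-refl
  where
  go : ∀ fuel b T → length T ≤ fuel → ¬ ¬ (∃[ Fs ] LZFrom S b T Fs)
  go fuel       b []      _       k = k ([] , [])
  go (suc fuel) b (x ∷ T) (s≤s T≤) k = ¬fresh λ occ → ¬¬maximal
    (λ F G → length F < length G) <-trans (<-irrefl refl)
    (λ F → Prefix _≡_ F (x ∷ T) × OccursBefore S b F)
    (applyUpTo (λ i → take i (x ∷ T)) (suc (suc (length T))))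
    (refl ∷ [] , occ)
    (λ G (pre , _) _ → subst (_∈ _) (prefix-take pre) (∈-applyUpTo⁺ (λ i → take i (x ∷ T)) (s≤s (length-mono pre))))
    (λ (F , (pre , occF) , longest) → copied occ pre (pre , occF , λ G preG occG → ≮⇒≥ (longest G (preG , occG))))
    where
    ¬fresh : ¬ ¬ OccursBefore S b [ x ]
    ¬fresh ¬occ = go fuel (b + 1) T T≤ λ (Fs , lz) → k (_ , fresh ¬occ ∷ lz)
    copied : ∀ {F} → OccursBefore S b [ x ] → Prefix _≡_ F (x ∷ T) → LongestPrefix (OccursBefore S b) (x ∷ T) F → ⊥
    copied {F} occ pre long@(_ , _ , longest) with T′ , eq ← prefix-split pre =
      go fuel (b + length F) T′ shorter λ (Fs , lz) →
        k (F ∷ Fs , subst (λ U → LZFrom S b U (F ∷ Fs)) (sym eq)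
                      (subst (λ U → LZPhrase S b U F) eq (copy occ long) ∷ lz))
      where
      shorter : length T′ ≤ fuel
      shorter = ≤-trans (ℕ.s≤s⁻¹ (begin
        1 + length T′          ≤⟨ +-monoˡ-≤ (length T′) (longest [ x ] (refl ∷ []) occ) ⟩
        length F + length T′   ≡⟨ length-++ F ⟨
        length (F ++ T′)       ≡⟨ cong length eq ⟨
        suc (length T)         ∎)) T≤
        where open ≤-Reasoning

lz-length : ∀ {S : List A} {b T Fs} → LZFrom S b T Fs → length Fs ≤ length T
lz-length []                              = z≤n
lz-length (_∷_ {F = F} {T = T} ph lz) =
  ≤-trans (+-mono-≤ (phrase-nonempty ph) (lz-length lz)) (≤-reflexive (sym (length-++ F)))

-- A minimal size is a maximum for the reversed order, with the sizes below `m` as candidates. Size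
-- 0 is excluded because the empty system derives nothing.
¬¬c : ∀ {S : List A} (G : Collage A m) → G Derives S →
      ¬ ¬ (∃[ m′ ] (c[ S ]≡ suc m′ × suc m′ ≤ m))
¬¬c {A = A} {m} {S} G der k = ¬¬maximal _>_ (flip <-trans) (<-irrefl refl)
  (λ m → Σ[ G ∈ Collage A m ] G Derives S) (upTo m) (G , der) (λ _ _ <m → ∈-upTo⁺ <m) least
  where
  least : ¬ (∃[ q ] ((Σ[ G ∈ Collage A q ] G Derives S) × ∀ r → Σ[ G ∈ Collage A r ] G Derives S → ¬ (q > r)))
  least (suc m′ , found , minimal) = k (m′ , (found , λ r Gr → ≮⇒≥ (minimal r Gr)) , ≮⇒≥ (minimal m (G , der)))
  least (zero , ([] , ()) , _)

¬¬quotient : (S : List A) (G : Collage A m) → G Derives S →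
             ¬ ¬ (∃[ Fs ] ∃[ m′ ] (IsLZ S Fs × c[ S ]≡ suc m′ × suc m′ ≤ m))
¬¬quotient S G der k = ¬¬lz S 0 S λ (Fs , lz) → ¬¬c G der λ (m′ , cS , m′≤) → k (Fs , m′ , lz , cS , m′≤)

trivialCollage : (S : List A) → 1 ≤ length S → ∃[ m ] (m ≤ suc (length S * 2) × Σ[ G ∈ Collage A m ] G Derives S)
trivialCollage S 1≤ with m , m≤ , r ← builds⇒derives 1≤ (builds-word S (0 , z≤n , [] , [])) =
  m , subst (m ≤_) (cong suc (+-identityʳ _)) m≤ , r

-- The number of phrases is at most `n` and the minimal size at most `2n + 1`, so only finitely many
-- fractions arise, whatever the alphabet.
quotient-candidate : ∀ {q} → 1 ≤ n → Quotient n q →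
                     q ∈ cartesianProductWith (λ k m → pos k / suc m) (upTo (suc n)) (upTo (suc (n * 2)))
quotient-candidate {n} 1≤n (quotient _ S (Fs , lz , refl) (_ , minimal)) = ∈-cartesianProductWith⁺ _
  (∈-upTo⁺ (s≤s (subst (length Fs ≤_) |S| (lz-length lz))))
  (∈-upTo⁺ (subst (λ l → _ ≤ suc (l * 2)) |S| m≤))
  where
  |S| : length (toList S) ≡ n
  |S| = length-toList S
  triv = trivialCollage (toList S) (subst (1 ≤_) (sym |S|) 1≤n)
  m≤ = ≤-trans (minimal _ (proj₂ (proj₂ triv))) (proj₁ (proj₂ triv))

¬¬Ratio : ∀ {q} → 1 ≤ n → Quotient n q → ¬ ¬ (∃[ q ] Ratio[z,c] n q)
¬¬Ratio {n} 1≤n Q k = ¬¬maximal ℚ._<_ ℚ.<-trans (ℚ.<-irrefl refl) (Quotient n) _ Q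
  (λ r Qr _ → quotient-candidate 1≤n Qr)
  λ (q , Qq , top) → k (q , Qq , λ r Qr → ℚ.≮⇒≥ (top r Qr))

-- Fractions and powers of two

frac-≤ : ∀ a b c d → a * suc d ≤ c * suc b → pos a / suc b ℚ.≤ pos c / suc d
frac-≤ a b c d h = ℚ.toℚᵘ-cancel-≤ (begin
  toℚᵘ (pos a / suc b)  ≃⟨ ℚ.toℚᵘ-fromℚᵘ (mkℚᵘ (pos a) b) ⟩
  mkℚᵘ (pos a) b        ≤⟨ *≤* (subst₂ ℤ._≤_ (ℤ.pos-* a (suc d)) (ℤ.pos-* c (suc b)) (ℤ.+≤+ h)) ⟩
  mkℚᵘ (pos c) d        ≃⟨ ℚ.toℚᵘ-fromℚᵘ (mkℚᵘ (pos c) d) ⟨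
  toℚᵘ (pos c / suc d)  ∎)
  where open ℚᵘ.≤-Reasoning

frac-* : ∀ a b ℓ → (pos a / suc b) ℚ.* (pos ℓ / 1) ≡ pos (a * ℓ) / suc b
frac-* a b ℓ = ℚ.toℚᵘ-injective (begin
  toℚᵘ ((pos a / suc b) ℚ.* (pos ℓ / 1))
    ≈⟨ ℚ.toℚᵘ-homo-* (pos a / suc b) (pos ℓ / 1) ⟩
  toℚᵘ (pos a / suc b) ℚᵘ.* toℚᵘ (pos ℓ / 1)
    ≈⟨ ℚᵘ.*-cong (ℚ.toℚᵘ-fromℚᵘ (mkℚᵘ (pos a) b)) (ℚ.toℚᵘ-fromℚᵘ (mkℚᵘ (pos ℓ) 0)) ⟩
  mkℚᵘ (pos a) b ℚᵘ.* mkℚᵘ (pos ℓ) 0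
    ≈⟨ *≡* (cong₂ ℤ._*_ (sym (ℤ.pos-* a ℓ)) (cong pos (sym (*-identityʳ (suc b))))) ⟩
  mkℚᵘ (pos (a * ℓ)) b
    ≈⟨ ℚ.toℚᵘ-fromℚᵘ (mkℚᵘ (pos (a * ℓ)) b) ⟨
  toℚᵘ (pos (a * ℓ) / suc b)  ∎)
  where open ℚᵘ.≃-Reasoning

2^-log : ∀ ℓ n → 1 ≤ n → ℓ ≤ ⌊log₂ n ⌋ → 2^ ℓ ≤ n
2^-log zero    n             1≤n _  = 1≤n
2^-log (suc ℓ) (suc zero)    _   ()
2^-log (suc ℓ) n@(suc (suc _)) _ ℓ< = begin
  2^ ℓ + 2^ ℓ            ≤⟨ +-mono-≤ ih (≤-trans ih (⌊n/2⌋≤⌈n/2⌉ n)) ⟩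
  ⌊ n /2⌋ + ⌈ n /2⌉      ≡⟨ ⌊n/2⌋+⌈n/2⌉≡n n ⟩
  n                      ∎
  where
  open ≤-Reasoning
  ih = 2^-log ℓ ⌊ n /2⌋ (s≤s z≤n) (subst (ℓ ≤_) (sym (⌊log₂⌊n/2⌋⌋≡⌊log₂n⌋∸1 n)) (<⇒≤pred ℓ<))

2^-+ : ∀ a b → 2^ (a + b) ≡ 2^ a * 2^ b
2^-+ zero    b = sym (+-identityʳ (2^ b))
2^-+ (suc a) b = trans (cong₂ _+_ (2^-+ a b) (2^-+ a b)) (sym (*-distribʳ-+ (2^ b) (2^ a) (2^ a)))

-- A hard string of each length

record HardString (M n : ℕ) : Set where
  field
    string  : List (ℕ × Bool)
    length≡ : length string ≡ n
    cheap   : ∃[ m ] (m ≤ 12 * 2^ M × Σ[ G ∈ Collage (ℕ × Bool) m ] G Derives string)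
    costly  : ∀ {Fs} → IsLZ string Fs → M * 2^ M ≤ length Fs + length Fs

hardString : ∀ M n → 1 ≤ n → 2^ M * 2^ M ≤ n → HardString M n
hardString M n 1≤n K²≤n = record { string = S ; length≡ = |S| ; cheap = cheap ; costly = costly }
  where
  K = 2^ M
  rs = rows M
  body = spell K rs
  body≤K² : length rs * K ≤ K * K
  body≤K² = *-monoˡ-≤ K (≤-trans (n≤1+n _) (≤-reflexive (length-rows M)))
  -- The padding follows the rows, so it offers no earlier occurrence to their windows.
  padding = replicate (n ∸ length body) (0 , false)
  S = body ++ padding
  body≤n : length body ≤ n
  body≤n = ≤-trans (≤-reflexive (length-spell K rs)) (≤-trans body≤K² K²≤n)
  |S| : length S ≡ n
  |S| = trans (length-++ body)
    (trans (cong (length body +_) (length-replicate (n ∸ length body))) (m+[n∸m]≡n body≤n))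
  start : Builds (length (word K off) * 2 + 0) [ word K off ]
  start = builds-word (word K off) (0 , z≤n , [] , [])
  allRows = builds-steps (steps-history M) (here refl) start
  available : All (_∈ map (word K) (history M) ++ [ word K off ]) (map (rowWord K) rs)
  available = All.map⁺ (All.map
    (λ ρ∈ → ∈-++⁺ˡ (Any.map⁺ (Any.map (λ same → applyUpTo-cong K λ c c< → cong (c ,_) (same c c<)) ρ∈)))
    (rows⊆history M))
  built = builds-⊆ (here refl ∷ []) (builds-pair (there (here refl)) (here refl)
            (builds-replicate (n ∸ length body) (0 , false) (builds-concat available allRows)))
  cheap : ∃[ m ] (m ≤ 12 * K × Σ[ G ∈ Collage (ℕ × Bool) m ] G Derives S)
  cheap with m , m≤ , r ← builds⇒derives (subst (1 ≤_) (sym |S|) 1≤n) built = m , ≤-trans m≤ size , r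
    where
    open ≤-Reasoning
    -- The 4 counts two rules for the padding, one to append it and one for the final copy. The rest
    -- is one rule per concatenated row, five per row of the history and two per letter of the
    -- initial row.
    size : 4 + (length (map (rowWord K) rs) + (length (history M) * 5 + (length (word K off) * 2 + 0))) ≤ 12 * K
    size = begin
      4 + (length (map (rowWord K) rs) + (length (history M) * 5 + (length (word K off) * 2 + 0)))
        ≡⟨ cong₂ (λ h w → 4 + (length (map (rowWord K) rs) + (h * 5 + (w * 2 + 0))))
             (length-history M) (length-word K off) ⟩
      4 + (length (map (rowWord K) rs) + (K * 5 + (K * 2 + 0)))
        ≡⟨ cong (λ l → 4 + (l + (K * 5 + (K * 2 + 0)))) (length-map (rowWord K) rs) ⟩
      4 + (length rs + (K * 5 + (K * 2 + 0)))
        ≤⟨ +-mono-≤ (*-monoʳ-≤ 4 (2^-pos M)) (+-monoˡ-≤ _ (≤-trans (n≤1+n _) (≤-reflexive (length-rows M)))) ⟩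
      4 * K + (K + (K * 5 + (K * 2 + 0)))  ≡⟨ total K ⟩
      12 * K                               ∎
      where
      total : ∀ K → 4 * K + (K + (K * 5 + (K * 2 + 0))) ≡ 12 * K
      total = solve-∀
  costly : ∀ {Fs} → IsLZ S Fs → M * K ≤ length Fs + length Fs
  costly {Fs} lz = subst (_≤ length Fs + length Fs) (totalWindows-rows M) (+-mono-≤ few few)
    where
    ends : length rs * K ≤ length S
    ends = ≤-trans (≤-reflexive (sym (length-spell K rs))) (≤-trans body≤n (≤-reflexive (sym |S|)))
    few : totalWindows rs ≤ length Fs
    few = subst (_≤ length Fs) (length-placed K 0 rs)
      (windows≤phrases lz refl z≤n z≤n (spread-spell K 0 rs (good-rows M) ends)
        (unseen-spell K [] rs padding (separated-rows M) (good-rows M)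
          (All.tabulate λ _ → All.tabulate λ _ _ _ ())))

-- The two bounds

quotientList : ∀ {S : List A} {k m} → DecidableEquality A → length S ≡ n →
               z[ S ]≡ k → c[ S ]≡ suc m → Quotient n (pos k / suc m)
quotientList {S = S} {k} {m} _≟ᴬ_ refl zS cS = quotient _≟ᴬ_ (fromList S)
  (subst (z[_]≡ k) (sym (toList∘fromList S)) zS) (subst (c[_]≡ suc m) (sym (toList∘fromList S)) cS)

-- The constant 14 is twice the 7 of `z-bound`, because `suc ℓ ≤ ℓ + ℓ` for `1 ≤ ℓ`.
upper : ∀ {n q} → 1 ≤ ⌊log₂ n ⌋ → Quotient n q → q ℚ.≤ (pos 14 / 1) ℚ.* log n
upper {n} 1≤ℓ (quotient {m = m} _ S (Fs , lz , refl) ((G , der) , _)) =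
  subst (pos (length Fs) / suc m ℚ.≤_) (sym (frac-* 14 0 ℓ)) (frac-≤ (length Fs) m (14 * ℓ) 0 (begin
    length Fs * 1          ≡⟨ *-identityʳ (length Fs) ⟩
    length Fs              ≤⟨ z-bound G der lz (s≤s z≤n) ⟩
    suc ⌊log₂ length (toList S) ⌋ * (7 * suc m) ≡⟨ cong (λ l → suc ⌊log₂ l ⌋ * (7 * suc m)) (length-toList S) ⟩
    suc ℓ * (7 * suc m)    ≤⟨ *-monoˡ-≤ (7 * suc m) (+-monoˡ-≤ ℓ 1≤ℓ) ⟩
    (ℓ + ℓ) * (7 * suc m)  ≡⟨ rearrange ℓ (suc m) ⟩
    14 * ℓ * suc m         ∎))
  where
  open ≤-Reasoning
  ℓ = ⌊log₂ n ⌋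
  rearrange : ∀ ℓ m → (ℓ + ℓ) * (7 * m) ≡ 14 * ℓ * m
  rearrange = solve-∀

-- With `M` the rounded half of the logarithm `ℓ`, the square of `2^ M` is at most `n`. The ratio is
-- at least `M * 2^ M / 2` over `12 * 2^ M`, that is `M / 24`, and `ℓ ≤ 2M + 1 ≤ 3M` makes this at
-- least `ℓ / 72`.
lower : ∀ {n} → 4 ≤ n → ¬ ¬ (∃[ q ] (Quotient n q × (pos 1 / 72) ℚ.* log n ℚ.≤ q))
lower {n} 4≤n k = ¬¬quotient string G der λ (Fs , m′ , lz , cS , m′≤) →
  k (_ , quotientList (×-≡-dec _≟_ Bool._≟_) length≡ (Fs , lz , refl) cS ,
     bound Fs m′ (costly lz) (≤-trans m′≤ m≤))
  where
  ℓ = ⌊log₂ n ⌋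
  M = ⌊ ℓ /2⌋
  K²≤n : 2^ M * 2^ M ≤ n
  K²≤n = subst (_≤ n) (2^-+ M M) (2^-log (M + M) n (≤-trans (s≤s z≤n) 4≤n)
    (≤-trans (+-monoʳ-≤ M (⌊n/2⌋≤⌈n/2⌉ ℓ)) (≤-reflexive (⌊n/2⌋+⌈n/2⌉≡n ℓ))))
  open HardString (hardString M n (≤-trans (s≤s z≤n) 4≤n) K²≤n)
  m≤  = proj₁ (proj₂ cheap)
  G   = proj₁ (proj₂ (proj₂ cheap))
  der = proj₂ (proj₂ (proj₂ cheap))
  1≤M : 1 ≤ M
  1≤M = ⌊n/2⌋-mono (⌊log₂⌋-mono-≤ 4≤n)
  ℓ≤3M : ℓ ≤ 3 * M
  ℓ≤3M = begin
    ℓ                    ≡⟨ ⌊n/2⌋+⌈n/2⌉≡n ℓ ⟨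
    M + ⌈ ℓ /2⌉          ≤⟨ +-monoʳ-≤ M (⌊n/2⌋-mono (n≤1+n (suc ℓ))) ⟩
    M + suc M            ≤⟨ +-monoʳ-≤ M (+-monoˡ-≤ M 1≤M) ⟩
    M + (M + M)          ≡⟨ cong (λ z → M + (M + z)) (+-identityʳ M) ⟨
    3 * M                ∎
    where open ≤-Reasoning
  bound : ∀ (Fs : List (List (ℕ × Bool))) m′ → M * 2^ M ≤ length Fs + length Fs → suc m′ ≤ 12 * 2^ M →
          (pos 1 / 72) ℚ.* log n ℚ.≤ pos (length Fs) / suc m′
  bound Fs m′ costly m′≤ = subst (ℚ._≤ pos (length Fs) / suc m′) (sym (frac-* 1 71 ℓ))
   (frac-≤ (1 * ℓ) 71 (length Fs) m′ (begin
    1 * ℓ * suc m′                   ≡⟨ cong (_* suc m′) (*-identityˡ ℓ) ⟩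
    ℓ * suc m′                       ≤⟨ *-mono-≤ ℓ≤3M m′≤ ⟩
    3 * M * (12 * 2^ M)              ≡⟨ rearrange M (2^ M) ⟩
    36 * (M * 2^ M)                  ≤⟨ *-monoʳ-≤ 36 costly ⟩
    36 * (length Fs + length Fs)     ≡⟨ rearrange′ (length Fs) ⟩
    length Fs * 72                   ∎))
    where
    open ≤-Reasoning
    rearrange : ∀ M K → 3 * M * (12 * K) ≡ 36 * (M * K)
    rearrange = solve-∀
    rearrange′ : ∀ f → 36 * (f + f) ≡ f * 72
    rearrange′ = solve-∀

corollary15 : Ratio[z,c] ∈Θ log
corollary15 =
  pos 1 / 72 , pos 14 / 1 , 4 , ℚ.positive⁻¹ (pos 1 / 72) , ℚ.positive⁻¹ (pos 14 / 1) , λ n 4≤n →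
    (λ k → lower 4≤n λ (q , Q , _) → ¬¬Ratio (≤-trans (s≤s z≤n) 4≤n) Q k) ,
    (λ q (Q , top) →
      -- Comparison of rationals is decidable, so the double negation around the hard quotient can
      -- be eliminated.
      decidable-stable (_ ℚ.≤? q) (λ ≰q → lower 4≤n λ (q′ , Q′ , ≤q′) → ≰q (ℚ.≤-trans ≤q′ (top q′ Q′))) ,
      upper (≤-trans (s≤s z≤n) (⌊log₂⌋-mono-≤ 4≤n)) Q)
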